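{- Let $l,k\ge 1$ be integers and let $a\times A$, $b\times B$ and $c\times C$ be rectangular Young diagrams contained in $l\times k$ (so $0\le a,b,c\le l$ and $0\le A,B,C\le k$). Then the following are equivalent: (I) there exist Young diagrams $\lambda,\mu,\nu\subseteq l\times k$ containing $a\times A$, $b\times B$ and $c\times C$, respectively, such that $\sigma_\lambda\cdot\sigma_\mu\cdot\sigma_\nu\neq 0$; (II) $\sigma_{a\times A}\cdot\sigma_{b\times B}\cdot\sigma_{c\times C}\neq 0$; (III) all of the following five conditions hold: (i) $a+b\le l$ or $A+B\le k$; (ii) $a+c\le l$ or $A+C\le k$; (iii) $b+c\le l$ or $B+C\le k$; (iv) $a+b+c\le l$ or $A+B+C\le 2k$; (v) $a+b+c\le 2l$ or $A+B+C\le k$. Here the products are taken in the classical cohomology ring $\mathrm{H}^*(Gr(l,\mathbb{C}^{l+k}),\mathbb{Z})$.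
   Context: Partitions are identified with their Young diagrams. $a\times A$ denotes the rectangular Young diagram with $a$ rows and $A$ columns; $\lambda\subseteq l\times k$ means that $\lambda$ has at most $l$ rows and $\lambda_1\le k$. The classical cohomology ring $\mathrm{H}^*(Gr(l,\mathbb{C}^{l+k}),\mathbb{Z})$ of the Grassmannian of $l$-dimensional subspaces of $\mathbb{C}^{l+k}$ has an additive basis of Schubert classes $\{\sigma_\lambda\}_{\lambda\subseteq l\times k}$, with product $\sigma_\lambda\cdot\sigma_\mu=\sum_{\nu\subseteq l\times k}c_{\lambda,\mu}^{\nu}\sigma_\nu$, where $c_{\lambda,\mu}^\nu$ is the Littlewood-Richardson coefficient. -}

module Defs where

open import Data.Bool using (if_then_else_)
open import Data.Fin as Fin using (Fin; zero; suc; toℕ; fromℕ<)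
open import Data.Fin.Properties as Finₚ using (all?)
open import Data.Integer as ℤ using (ℤ; +_; 0ℤ; 1ℤ)
open import Data.List using (List; []; _∷_; map; mapMaybe; foldr; filter; length; concatMap; reverse; inits; allFin; cartesianProductWith)
open import Data.List.Relation.Unary.All as All using (All)
open import Data.Maybe as Maybe using ()
open import Data.Nat using (ℕ; zero; suc; _≤_; _<_; _≤?_; _<?_; _≟_; z≤n; s≤s)
open import Data.Nat.Properties using (≤-refl; ≤-<-trans)
open import Data.Product using (_×_)
open import Data.Vec as Vec using (Vec; []; _∷_; lookup; tabulate; toList)
open import Data.Vec.Properties using (≡-dec)
open import Data.Vec.Relation.Unary.Linked using (Linked; []; [-]; _∷_; linked?)
open import Function using (_∘_)
open import Level using (0ℓ)
open import Relation.Binary using (Rel)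
open import Relation.Binary.PropositionalEquality using (_≡_)
open import Relation.Nullary using (Dec; does; yes; no; ¬_; contradiction; _×-dec_; _→-dec_; ¬?)
open import Relation.Nullary.Decidable using (dec⇒maybe)

-- Young diagrams contained in the l × k rectangle: the parts, padded with
-- zeros to length l, form a weakly decreasing sequence with values in 0 … k.
-- The proof component is propositionally unique, so two diagrams are equal
-- as soon as their parts are.
record Young (l k : ℕ) : Set where
  constructor young
  field
    parts      : Vec (Fin (suc k)) l
    decreasing : Linked Fin._≥_ parts

open Young public

row : ∀ {l k} → Young l k → Fin l → ℕ
row α i = toℕ (lookup (parts α) i)

infix 4 _⊆_
_⊆_ : ∀ {l k} → Young l k → Young l k → Set
α ⊆ β = ∀ i → row α i ≤ row β i

linked-tabulate : ∀ {A : Set} {R : Rel A 0ℓ} {n} (f : Fin n → A) →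
                  (∀ {i j} → i Fin.≤ j → R (f i) (f j)) → Linked R (tabulate f)
linked-tabulate {n = 0}           f mono = []
linked-tabulate {n = 1}           f mono = [-]
linked-tabulate {n = suc (suc n)} f mono =
  mono z≤n ∷ linked-tabulate (f ∘ suc) (mono ∘ s≤s)

-- The rectangle a × A, with a rows and A columns.
module _ {l k : ℕ} (a A : ℕ) (a≤l : a ≤ l) (A≤k : A ≤ k) where

  rectRow : Fin l → Fin (suc k)
  rectRow i with toℕ i <? a
  ... | yes _ = fromℕ< (s≤s A≤k)
  ... | no  _ = zero

  rectRow-decreasing : ∀ {i j} → i Fin.≤ j → rectRow i Fin.≥ rectRow j
  rectRow-decreasing {i} {j} i≤j with toℕ i <? a | toℕ j <? a
  ... | yes _   | yes _   = ≤-refl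
  ... | yes _   | no  _   = z≤n
  ... | no  i≮a | yes j<a = contradiction (≤-<-trans i≤j j<a) i≮a
  ... | no  _   | no  _   = ≤-refl

  rect : Young l k
  rect = young (tabulate rectRow) (linked-tabulate rectRow rectRow-decreasing)

vecs : ∀ {A : Set} → List A → (n : ℕ) → List (Vec A n)
vecs xs zero    = [] ∷ []
vecs xs (suc n) = cartesianProductWith _∷_ xs (vecs xs n)

-- Each diagram in the rectangle occurs exactly once.
allYoung : ∀ l k → List (Young l k)
allYoung l k = mapMaybe (λ p → Maybe.map (young p) (dec⇒maybe (linked? (λ i j → j Fin.≤? i) p)))
                        (vecs (allFin (suc k)) l)

-- A filling of the l × k rectangle: 0 is an empty cell, and the letters are
-- 1 … l.  Letters above l cannot occur in a tableau whose content has at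
-- most l parts.
Filling : ℕ → ℕ → Set
Filling l k = Vec (Vec (Fin (suc l)) k) l

allFillings : ∀ l k → List (Filling l k)
allFillings l k = vecs (vecs (allFin (suc l)) k) l

count : ℕ → List ℕ → ℕ
count r w = length (filter (r ≟_) w)

module _ {l k : ℕ} where

  entry : Filling l k → Fin l → Fin k → ℕ
  entry T i j = toℕ (lookup (lookup T i) j)

  -- The rows are read from right to left, from the top row to the bottom row.
  -- The zeros of the empty cells are kept: only letters ≥ 1 are ever counted.
  readingWord : Filling l k → List ℕ
  readingWord T = concatMap (λ r → reverse (map toℕ (toList r))) (toList T)

  InSkew : Young l k → Young l k → Fin l → Fin k → Set
  InSkew α γ i j = row α i ≤ toℕ j × toℕ j < row γ i

  HasShape : Young l k → Young l k → Filling l k → Set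
  HasShape α γ T = α ⊆ γ × (∀ i j → (InSkew α γ i j → ¬ entry T i j ≡ 0)
                                  × (¬ entry T i j ≡ 0 → InSkew α γ i j))

  RowsWeak : Young l k → Young l k → Filling l k → Set
  RowsWeak α γ T = ∀ i j j′ → j Fin.< j′ → InSkew α γ i j → InSkew α γ i j′ →
                   entry T i j ≤ entry T i j′

  ColumnsStrict : Young l k → Young l k → Filling l k → Set
  ColumnsStrict α γ T = ∀ i i′ j → i Fin.< i′ → InSkew α γ i j → InSkew α γ i′ j →
                        entry T i j < entry T i′ j

  HasContent : Young l k → Filling l k → Set
  HasContent β T = ∀ (r : Fin l) → count (suc (toℕ r)) (readingWord T) ≡ row β r

  IsLattice : Filling l k → Set
  IsLattice T = All (λ w → ∀ (r : Fin l) → count (suc (suc (toℕ r))) w ≤ count (suc (toℕ r)) w)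
                    (inits (readingWord T))

  IsLRTableau : Young l k → Young l k → Young l k → Filling l k → Set
  IsLRTableau α β γ T = HasShape α γ T × RowsWeak α γ T × ColumnsStrict α γ T
                      × HasContent β T × IsLattice T

  inSkew? : ∀ α γ i j → Dec (InSkew α γ i j)
  inSkew? α γ i j = (row α i ≤? toℕ j) ×-dec (toℕ j <? row γ i)

  isLRTableau? : ∀ α β γ T → Dec (IsLRTableau α β γ T)
  isLRTableau? α β γ T =
          (all? (λ i → row α i ≤? row γ i)
            ×-dec all? λ i → all? λ j →
                    (inSkew? α γ i j →-dec ¬? (entry T i j ≟ 0))
              ×-dec (¬? (entry T i j ≟ 0) →-dec inSkew? α γ i j))
    ×-dec (all? λ i → all? λ j → all? λ j′ → (j Fin.<? j′) →-dec inSkew? α γ i j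
            →-dec inSkew? α γ i j′ →-dec (entry T i j ≤? entry T i j′))
    ×-dec (all? λ i → all? λ i′ → all? λ j → (i Fin.<? i′) →-dec inSkew? α γ i j
            →-dec inSkew? α γ i′ j →-dec (entry T i j <? entry T i′ j))
    ×-dec (all? λ r → count (suc (toℕ r)) (readingWord T) ≟ row β r)
    ×-dec All.all? (λ w → all? λ r → count (suc (suc (toℕ r))) w ≤? count (suc (toℕ r)) w)
                   (inits (readingWord T))

  -- The Littlewood-Richardson coefficient c^γ_{α,β}: the number of
  -- Littlewood-Richardson tableaux of shape γ/α and content β.
  lrCoeff : Young l k → Young l k → Young l k → ℕ
  lrCoeff α β γ = length (filter (isLRTableau? α β γ) (allFillings l k))

-- H*(Gr(l, ℂ^{l+k}), ℤ): the free ℤ-module on the Schubert classes, a class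
-- being given by its coefficients in the Schubert basis.
Cohomology : ℕ → ℕ → Set
Cohomology l k = Young l k → ℤ

module _ {l k : ℕ} where

  σ : Young l k → Cohomology l k
  σ α β = if does (≡-dec Finₚ._≟_ (parts α) (parts β)) then 1ℤ else 0ℤ

  sumYoung : (Young l k → ℤ) → ℤ
  sumYoung f = foldr ℤ._+_ 0ℤ (map f (allYoung l k))

  -- The ℤ-bilinear extension of σ α · σ β = Σ_γ c^γ_{α,β} σ γ.
  infixl 7 _·_
  _·_ : Cohomology l k → Cohomology l k → Cohomology l k
  (x · y) γ = sumYoung λ α → sumYoung λ β → x α ℤ.* y β ℤ.* + lrCoeff α β γ

  Nonzero : Cohomology l k → Set
  Nonzero x = ¬ (∀ γ → x γ ≡ 0ℤ)

{-# OPTIONS --safe #-}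
module Submission where

-- Write α_r for the length of row r, with rows numbered from 0.
--
-- Necessity.  In a Littlewood–Richardson tableau of shape ε/α and content β the
-- lattice condition says that rows 0 … r + 1 contain at most as many letters
-- x + 1 as rows 0 … r contain letters x, and equal letters in rows p … q lie in
-- distinct columns between α_q and ε_p.  Together these give the inequalities
--   α_a + β_b ≤ ε_e  for a + b + 1 = l + e,     α_a + β_b ≤ k + ε_{a+b+1},
-- so if α ⊇ a × A and β ⊇ b × B, then ε contains the rectangles
-- (a + b − l) × (A + B) and (a + b) × (A + B − k).  The five conditions follow on
-- applying this to ε/α and then to δ/ε, where σ_ε occurs in σ_α σ_β and σ_δ in
-- σ_ε σ_γ.
--
-- Sufficiency.  A rectangle c × C can be added to ε as soon as ε_{l−c} ≤ k − C,
-- by letting the number of letters i + 1 in row i + s depend on s only.  The same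
-- construction adds b × B to a × A, after the forced first e = a + b − l rows of
-- length A + B have been split off; there is one free parameter, which the five
-- conditions allow to be chosen so that ε_{l−c} ≤ k − C.

open import Data.Bool using (true; false; if_then_else_)
open import Data.Fin as Fin using (Fin; zero; suc; toℕ; fromℕ<)
open import Data.Fin.Properties as Finₚ using (toℕ<n; toℕ-fromℕ<; toℕ-injective)
open import Data.Integer as ℤ using (ℤ; 0ℤ)
import Data.Integer.Properties as ℤₚ
open import Data.List using (module Inits; List; []; _∷_; _++_; [_]; map; foldr; filter; length; reverse; concatMap; inits; allFin)
open import Data.List.Properties using (filter-++; length-++; unfold-reverse; ++-assoc; ++-identityʳ; ++-conicalˡ; ∷-injective)
open import Data.List.Membership.Propositional using (_∈_; lose)
open import Data.List.Membership.Propositional.Properties using (∈-cartesianProductWith⁺; ∈-filter⁺; ∈-filter⁻; ∈-length; ∈-allFin)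
open import Data.List.Relation.Unary.All using (All; []; _∷_)
open import Data.List.Relation.Unary.All.Properties using (map⁺; map⁻)
open import Data.List.Relation.Unary.Any using (here; there)
import Data.List.Relation.Unary.Any.Properties as Anyₚ
open import Data.Maybe as Maybe using (just)
open import Data.Maybe.Relation.Unary.Any as MAny using (just)
open import Data.Nat
open import Data.Nat.Properties
open import Algebra.Properties.CommutativeSemigroup +-commutativeSemigroup using (interchange)
open import Data.Product using (_×_; _,_; proj₁; proj₂; ∃-syntax)
open import Data.Sum using (_⊎_; inj₁; inj₂; map₁; map₂)
open import Data.Vec using (Vec; []; _∷_; lookup; tabulate; toList)
open import Data.Vec.Properties using (lookup∘tabulate; ≡-dec)
open import Data.Vec.Relation.Unary.Linked using (Linked; []; [-]; _∷_; linked?; irrelevant)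
open import Function using (_∘_; _⇔_; mk⇔)
open import Relation.Binary.PropositionalEquality hiding ([_])
open import Relation.Nullary using (Dec; does; yes; no; ¬_; contradiction; _×-dec_; _⊎-dec_)
open import Relation.Nullary.Decidable using (dec-true; dec-false; dec⇒maybe; decidable-stable)
open import Defs

private variable
  X : Set
  m n k l : ℕ

-- Finite sums and zero extensions

∑ : ℕ → (ℕ → ℕ) → ℕ
∑ zero    f = 0
∑ (suc n) f = ∑ n f + f n

∑-front : ∀ n f → ∑ (suc n) f ≡ f 0 + ∑ n (f ∘ suc)
∑-front zero    f = +-comm 0 (f 0)
∑-front (suc n) f = trans (cong (_+ f (suc n)) (∑-front n f)) (+-assoc (f 0) _ _)

∑-cong : ∀ n {f g} → (∀ i → i < n → f i ≡ g i) → ∑ n f ≡ ∑ n g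
∑-cong zero    eq = refl
∑-cong (suc n) eq = cong₂ _+_ (∑-cong n λ i i<n → eq i (m<n⇒m<1+n i<n)) (eq n ≤-refl)

∑-mono : ∀ n {f g} → (∀ i → i < n → f i ≤ g i) → ∑ n f ≤ ∑ n g
∑-mono zero    le = z≤n
∑-mono (suc n) le = +-mono-≤ (∑-mono n λ i i<n → le i (m<n⇒m<1+n i<n)) (le n ≤-refl)

∑-+ : ∀ n f g → ∑ n (λ i → f i + g i) ≡ ∑ n f + ∑ n g
∑-+ zero    f g = refl
∑-+ (suc n) f g = trans (cong (_+ (f n + g n)) (∑-+ n f g)) (interchange (∑ n f) (∑ n g) (f n) (g n))

∑-zero : ∀ n {f} → (∀ i → i < n → f i ≡ 0) → ∑ n f ≡ 0
∑-zero zero    eq = refl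
∑-zero (suc n) eq = cong₂ _+_ (∑-zero n λ i i<n → eq i (m<n⇒m<1+n i<n)) (eq n ≤-refl)

∑-swap : ∀ m n (f : ℕ → ℕ → ℕ) → ∑ m (λ i → ∑ n (f i)) ≡ ∑ n (λ j → ∑ m (λ i → f i j))
∑-swap zero    n f = sym (∑-zero n λ _ _ → refl)
∑-swap (suc m) n f = trans (cong (_+ ∑ n (f m)) (∑-swap m n f)) (sym (∑-+ n _ (f m)))

∑-monoˡ : ∀ {m n} f → m ≤ n → ∑ m f ≤ ∑ n f
∑-monoˡ {m} {n} f m≤n = go (≤⇒≤′ m≤n)
  where
  go : ∀ {n} → m ≤′ n → ∑ m f ≤ ∑ n f
  go (≤′-reflexive refl) = ≤-refl
  go (≤′-step p)         = ≤-trans (go p) (m≤m+n _ _)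

∑-shift : ∀ p n f → ∑ (n + p) f ≡ ∑ p f + ∑ n (λ i → f (i + p))
∑-shift p zero    f = sym (+-identityʳ _)
∑-shift p (suc n) f = trans (cong (_+ f (n + p)) (∑-shift p n f)) (+-assoc (∑ p f) _ _)

⟦_⟧ : ∀ {P : Set} → Dec P → ℕ
⟦ p? ⟧ = if does p? then 1 else 0

⟦⟧-yes : ∀ {P : Set} (p? : Dec P) → P → ⟦ p? ⟧ ≡ 1
⟦⟧-yes p? p rewrite dec-true p? p = refl

⟦⟧-no : ∀ {P : Set} (p? : Dec P) → ¬ P → ⟦ p? ⟧ ≡ 0
⟦⟧-no p? ¬p rewrite dec-false p? ¬p = refl

⟦⟧≤1 : ∀ {P : Set} (p? : Dec P) → ⟦ p? ⟧ ≤ 1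
⟦⟧≤1 (yes _) = ≤-refl
⟦⟧≤1 (no _)  = z≤n

-- Turns a row length into a count of columns, so that lengths can be compared column by column.
∑-initial : ∀ n {v} → v ≤ n → ∑ n (λ j → ⟦ j <? v ⟧) ≡ v
∑-initial zero    z≤n = refl
∑-initial (suc n) {v} v≤1+n with n <? v
... | yes n<v rewrite ≤-antisym v≤1+n n<v = trans (cong₂ _+_ prefix (⟦⟧-yes (n <? suc n) ≤-refl)) (+-comm n 1)
  where
  prefix : ∑ n (λ j → ⟦ j <? suc n ⟧) ≡ n
  prefix = trans (∑-cong n λ j j<n → trans (⟦⟧-yes (j <? suc n) (m<n⇒m<1+n j<n)) (sym (⟦⟧-yes (j <? n) j<n)))
                 (∑-initial n ≤-refl)
... | no n≮v = trans (cong₂ _+_ (∑-initial n (≮⇒≥ n≮v)) (⟦⟧-no (n <? v) n≮v)) (+-identityʳ v)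

∑-unique : ∀ n {P : ℕ → Set} (P? : ∀ i → Dec (P i)) → (∀ i i′ → i < i′ → P i → ¬ P i′) →
           ∑ n (λ i → ⟦ P? i ⟧) ≤ 1
∑-unique zero    P? once = z≤n
∑-unique (suc n) P? once with P? n
... | no _   = ≤-trans (≤-reflexive (+-identityʳ _)) (∑-unique n P? once)
... | yes pn = ≤-reflexive (cong (_+ 1) (∑-zero n λ i i<n → ⟦⟧-no (P? i) λ pi → once i n i<n pi pn))

-- With extension by zero, rows and columns are indexed by plain natural numbers, and shifted
-- indices carry no bounds.
ext : ∀ {n} → (Fin n → ℕ) → ℕ → ℕ
ext {zero}  f i       = 0
ext {suc n} f zero    = f zero
ext {suc n} f (suc i) = ext (f ∘ suc) i

ext-toℕ : ∀ {n} (f : Fin n → ℕ) i → ext f (toℕ i) ≡ f i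
ext-toℕ f zero    = refl
ext-toℕ f (suc i) = ext-toℕ (f ∘ suc) i

ext-≥ : ∀ {n} (f : Fin n → ℕ) {i} → n ≤ i → ext f i ≡ 0
ext-≥ {zero}  f n≤i       = refl
ext-≥ {suc n} f (s≤s n≤i) = ext-≥ (f ∘ suc) n≤i

data Index (n : ℕ) : ℕ → Set where
  inside  : (i : Fin n) → Index n (toℕ i)
  outside : ∀ {i} → n ≤ i → Index n i

index : ∀ n i → Index n i
index n i with i <? n
... | yes i<n = subst (Index n) (toℕ-fromℕ< i<n) (inside (fromℕ< i<n))
... | no  i≮n = outside (≮⇒≥ i≮n)

index< : ∀ {n i} → i < n → ∃[ j ] toℕ {n} j ≡ i
index< i<n = fromℕ< i<n , toℕ-fromℕ< i<n

-- Reading words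

++-split : (ys zs : List X) {xs ws : List X} → ys ++ zs ≡ xs ++ ws →
           (∃[ us ] ys ≡ xs ++ us) ⊎ (∃[ us ] xs ≡ ys ++ us × zs ≡ us ++ ws)
++-split []       zs {xs}     eq = inj₂ (xs , refl , eq)
++-split (y ∷ ys) zs {[]}     eq = inj₁ (y ∷ ys , refl)
++-split (y ∷ ys) zs {x ∷ xs} eq with ∷-injective eq
... | refl , eq′ with ++-split ys zs eq′
...   | inj₁ (us , p)     = inj₁ (us , cong (y ∷_) p)
...   | inj₂ (us , p , q) = inj₂ (us , cong (y ∷_) p , q)

module _ {X : Set} {P : List X → Set} where

  inits⁺ : ∀ ws → (∀ us vs → ws ≡ us ++ vs → P us) → All P (inits ws)
  inits⁺ ws h = h [] ws refl ∷ go ws h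
    where
    -- `inits ws` unfolds to `[] ∷ Inits.tail ws`. The predicate varies because each step absorbs
    -- the letter `w` into it.
    go : ∀ {Q : List X → Set} ws → (∀ us vs → ws ≡ us ++ vs → Q us) → All Q (Inits.tail ws)
    go []       h = []
    go (w ∷ ws) h = h [ w ] ws refl ∷ map⁺ (go ws λ us vs eq → h (w ∷ us) vs (cong (w ∷_) eq))

  inits⁻ : ∀ us vs → All P (inits (us ++ vs)) → P us
  inits⁻ []       vs (p ∷ _)  = p
  inits⁻ (u ∷ us) vs (_ ∷ ps) = go us vs ps
    where
    go : ∀ {Q : List X → Set} {u} us vs → All Q (Inits.tail (u ∷ us ++ vs)) → Q (u ∷ us)
    go []       vs (p ∷ _)  = p
    go (_ ∷ us) vs (_ ∷ ps) = go us vs (map⁻ ps)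

count-++ : ∀ x us vs → count x (us ++ vs) ≡ count x us + count x vs
count-++ x us vs = trans (cong length (filter-++ (x ≟_) us vs)) (length-++ (filter (x ≟_) us))

count-∷ : ∀ x y ys → count x (y ∷ ys) ≡ ⟦ x ≟ y ⟧ + count x ys
count-∷ x y ys with does (x ≟ y)
... | true  = refl
... | false = refl

count-reverse : ∀ x ys → count x (reverse ys) ≡ count x ys
count-reverse x []       = refl
count-reverse x (y ∷ ys) = begin
  count x (reverse (y ∷ ys))               ≡⟨ cong (count x) (unfold-reverse y ys) ⟩
  count x (reverse ys ++ [ y ])            ≡⟨ count-++ x (reverse ys) [ y ] ⟩
  count x (reverse ys) + count x [ y ]     ≡⟨ cong₂ _+_ (count-reverse x ys) (trans (count-∷ x y []) (+-identityʳ _)) ⟩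
  count x ys + ⟦ x ≟ y ⟧                   ≡⟨ +-comm (count x ys) _ ⟩
  ⟦ x ≟ y ⟧ + count x ys                   ≡⟨ count-∷ x y ys ⟨
  count x (y ∷ ys)                         ∎
  where open ≡-Reasoning

rowWord : Vec (Fin m) k → List ℕ
rowWord v = reverse (map toℕ (toList v))

word : Vec (Vec (Fin m) k) n → List ℕ
word rows = concatMap rowWord (toList rows)

rowAt : Vec (Fin m) k → ℕ → ℕ
rowAt v = ext (λ j → toℕ (lookup v j))

at : Vec (Vec (Fin m) k) n → ℕ → ℕ → ℕ
at rows r j = ext (λ i → rowAt (lookup rows i) j) r

-- Content and lattice condition are both translated into these counts per letter and row, which
-- replace the reading word in the estimates.
occ : Vec (Vec (Fin m) k) n → ℕ → ℕ → ℕ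
occ {k = k} rows x r = ∑ k λ j → ⟦ x ≟ at rows r j ⟧

occ< : Vec (Vec (Fin m) k) n → ℕ → ℕ → ℕ
occ< rows x r = ∑ r (occ rows x)

count-rowWord : ∀ x (v : Vec (Fin m) k) → count x (rowWord v) ≡ ∑ k (λ j → ⟦ x ≟ rowAt v j ⟧)
count-rowWord x v = trans (count-reverse x (map toℕ (toList v))) (go v)
  where
  go : ∀ {k} (v : Vec (Fin m) k) → count x (map toℕ (toList v)) ≡ ∑ k (λ j → ⟦ x ≟ rowAt v j ⟧)
  go []      = refl
  go {k = suc k} (y ∷ v) = trans (count-∷ x (toℕ y) _) (trans (cong (⟦ x ≟ toℕ y ⟧ +_) (go v))
    (sym (∑-front k λ j → ⟦ x ≟ rowAt (y ∷ v) j ⟧)))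

occ<-∷ : ∀ (v : Vec (Fin m) k) (rows : Vec (Vec (Fin m) k) n) x r →
         occ< (v ∷ rows) x (suc r) ≡ count x (rowWord v) + occ< rows x r
occ<-∷ v rows x r = trans (∑-front r _) (cong (_+ occ< rows x r) (sym (count-rowWord x v)))

count-word : ∀ x (rows : Vec (Vec (Fin m) k) n) → count x (word rows) ≡ occ< rows x n
count-word x []         = refl
count-word {n = suc n} x (v ∷ rows) =
  trans (count-++ x (rowWord v) _) (trans (cong (count x (rowWord v) +_) (count-word x rows)) (sym (occ<-∷ v rows x n)))

-- A prefix of the word ends inside some row r.
prefix-counts : ∀ (rows : Vec (Vec (Fin m) k) n) us vs → word rows ≡ us ++ vs →
  us ≡ [] ⊎ ∃[ r ] (r < n × ∀ x → occ< rows x r ≤ count x us × count x us ≤ occ< rows x (suc r))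
prefix-counts []         us vs eq = inj₁ (++-conicalˡ us vs (sym eq))
prefix-counts (v ∷ rows) us vs eq with ++-split (rowWord v) (word rows) {us} {vs} eq
... | inj₁ (ws , eq′) = inj₂ (0 , s≤s z≤n , λ x → z≤n , (begin
  count x us                        ≤⟨ m≤m+n _ _ ⟩
  count x us + count x ws           ≡⟨ count-++ x us ws ⟨
  count x (us ++ ws)                ≡⟨ cong (count x) eq′ ⟨
  count x (rowWord v)               ≡⟨ +-identityʳ _ ⟨
  count x (rowWord v) + 0           ≡⟨ occ<-∷ v rows x 0 ⟨
  occ< (v ∷ rows) x 1               ∎))
  where open ≤-Reasoning
... | inj₂ (ws , refl , eq′) with prefix-counts rows ws vs eq′
-- A prefix ending exactly at the end of the first row is assigned to that row, since there may be
-- no next one.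
...   | inj₁ refl = inj₂ (0 , s≤s z≤n , λ x → z≤n , ≤-reflexive (begin
  count x (rowWord v ++ [])         ≡⟨ count-++ x (rowWord v) [] ⟩
  count x (rowWord v) + 0           ≡⟨ occ<-∷ v rows x 0 ⟨
  occ< (v ∷ rows) x 1               ∎))
  where open ≡-Reasoning
...   | inj₂ (r , r<n , bnd) = inj₂ (suc r , s≤s r<n , λ x →
  subst₂ _≤_ (sym (occ<-∷ v rows x r)) (sym (count-++ x (rowWord v) ws)) (+-monoʳ-≤ _ (proj₁ (bnd x))) ,
  subst₂ _≤_ (sym (count-++ x (rowWord v) ws)) (sym (occ<-∷ v rows x (suc r))) (+-monoʳ-≤ _ (proj₂ (bnd x))))

word-split : ∀ (rows : Vec (Vec (Fin m) k) n) i → ∃[ us ] ∃[ vs ]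
  (word rows ≡ us ++ rowWord (lookup rows i) ++ vs × ∀ x → count x us ≡ occ< rows x (toℕ i))
word-split (v ∷ rows) zero    = [] , word rows , refl , λ _ → refl
word-split (v ∷ rows) (suc i) with word-split rows i
... | us , vs , eq , cnt = rowWord v ++ us , vs ,
  trans (cong (rowWord v ++_) eq) (sym (++-assoc (rowWord v) us _)) ,
  λ x → trans (count-++ x (rowWord v) us) (trans (cong (count x (rowWord v) +_) (cnt x)) (sym (occ<-∷ v rows x (toℕ i))))

-- If y never stands to the right of x, then right-to-left reading meets every
-- x before any y.
rowWord-split : ∀ {x y} → x ≢ y → (v : Vec (Fin m) k) →
  (∀ j j′ → j Fin.< j′ → toℕ (lookup v j) ≡ x → toℕ (lookup v j′) ≢ y) →
  ∃[ us ] ∃[ vs ] (rowWord v ≡ us ++ vs × count x us ≡ count x (rowWord v) × count y us ≡ 0)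
rowWord-split x≢y [] _ = [] , [] , refl , refl , refl
rowWord-split {x = x} {y} x≢y (z ∷ v) sep with x ≟ toℕ z
... | no x≢z = let us , vs , eq , cx , cy = rowWord-split x≢y v (λ j j′ j<j′ → sep (suc j) (suc j′) (s≤s j<j′)) in
  us , vs ++ [ toℕ z ] ,
  trans (unfold-reverse (toℕ z) (map toℕ (toList v))) (trans (cong (_++ [ toℕ z ]) eq) (++-assoc us vs _)) ,
  (begin
    count x us                              ≡⟨ cx ⟩
    count x (rowWord v)                     ≡⟨ +-identityʳ _ ⟨
    count x (rowWord v) + 0                 ≡⟨ cong (count x (rowWord v) +_) (trans (count-∷ x (toℕ z) []) (cong (_+ 0) (⟦⟧-no (x ≟ toℕ z) x≢z))) ⟨
    count x (rowWord v) + count x [ toℕ z ] ≡⟨ count-++ x (rowWord v) _ ⟨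
    count x (rowWord v ++ [ toℕ z ])        ≡⟨ cong (count x) (unfold-reverse (toℕ z) (map toℕ (toList v))) ⟨
    count x (rowWord (z ∷ v))               ∎) ,
  cy
  where open ≡-Reasoning
-- The leftmost letter is read last, so the prefix has to be the whole row; `sep` keeps `y` out of
-- it.
... | yes x≡z = rowWord (z ∷ v) , [] , sym (++-identityʳ _) , refl ,
  trans (count-rowWord y (z ∷ v)) (∑-zero _ λ j j<k → ⟦⟧-no (y ≟ rowAt (z ∷ v) j) (none j j<k))
  where
  none : ∀ j → j < _ → y ≢ rowAt (z ∷ v) j
  none j j<k y≡ with index< j<k
  ... | zero  , refl = x≢y (trans x≡z (sym y≡))
  ... | suc i , refl = sep zero (suc i) (s≤s z≤n) (sym x≡z) (sym (trans y≡ (ext-toℕ (λ j → toℕ (lookup v j)) i)))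

-- Littlewood–Richardson tableaux

Antitone : (ℕ → ℕ) → Set
Antitone f = ∀ r → f (suc r) ≤ f r

antitone : ∀ {f} → Antitone f → ∀ {r s} → r ≤ s → f s ≤ f r
antitone {f} step {r} r≤s = go (≤⇒≤′ r≤s)
  where
  go : ∀ {s} → r ≤′ s → f s ≤ f r
  go (≤′-reflexive refl) = ≤-refl
  go (≤′-step p)         = ≤-trans (step _) (go p)

ρ : Young l k → ℕ → ℕ
ρ α = rowAt (parts α)

ρ-antitone : (α : Young l k) → Antitone (ρ α)
ρ-antitone α = go (decreasing α)
  where
  go : ∀ {v : Vec (Fin m) n} → Linked Fin._≥_ v → Antitone (rowAt v)
  go []              r       = z≤n
  go [-]             r       = z≤n
  go (_∷_ {xs = _ ∷ _} y≤x d) zero    = y≤x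
  go (_∷_ {xs = _ ∷ _} y≤x d) (suc r) = go d r

ρ-toℕ : (α : Young l k) (i : Fin l) → ρ α (toℕ i) ≡ row α i
ρ-toℕ α = ext-toℕ (row α)

ρ≤k : (α : Young l k) → ∀ r → ρ α r ≤ k
ρ≤k {l} α r with index l r
... | inside i    = subst (_≤ _) (sym (ρ-toℕ α i)) (s≤s⁻¹ (toℕ<n (lookup (parts α) i)))
... | outside l≤r = subst (_≤ _) (sym (ext-≥ (row α) l≤r)) z≤n

at-entry : (T : Filling l k) → ∀ i j → at T (toℕ i) (toℕ j) ≡ entry T i j
at-entry T i j = trans (ext-toℕ (λ i → rowAt (lookup T i) (toℕ j)) i) (ext-toℕ (entry T i) j)

at-cell : (T : Filling l k) → ∀ r j → at T r j ≢ 0 → ∃[ i ] ∃[ j′ ] (toℕ {l} i ≡ r × toℕ {k} j′ ≡ j)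
at-cell {l} {k} T r j ≢0 with index l r | index k j
... | inside i    | inside j′   = i , j′ , refl , refl
... | outside l≤r | _           = contradiction (ext-≥ (λ i → rowAt (lookup T i) j) l≤r) ≢0
... | inside i    | outside k≤j =
  contradiction (trans (ext-toℕ (λ i → rowAt (lookup T i) j) i) (ext-≥ (entry T i) k≤j)) ≢0

-- Unlike IsLRTableau, this type determines the three diagrams.
record LRTableau {l k : ℕ} (α β ε : Young l k) : Set where
  constructor lrTableau
  field
    filling : Filling l k
    isLR    : IsLRTableau α β ε filling

module _ {l k : ℕ} {α β ε : Young l k} (τ : LRTableau α β ε) where

  open LRTableau τ renaming (filling to T; isLR to lr)

  private
    shape   = proj₁ lr
    weak    = proj₁ (proj₂ lr)
    strict  = proj₁ (proj₂ (proj₂ lr))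
    content = proj₁ (proj₂ (proj₂ (proj₂ lr)))
    lattice = proj₂ (proj₂ (proj₂ (proj₂ lr)))

  α≤ε : ∀ r → ρ α r ≤ ρ ε r
  α≤ε r with index l r
  ... | inside i    = subst₂ _≤_ (sym (ρ-toℕ α i)) (sym (ρ-toℕ ε i)) (proj₁ shape i)
  ... | outside l≤r = subst (_≤ _) (sym (ext-≥ (row α) l≤r)) z≤n

  skew : ∀ i j → entry T i j ≢ 0 → InSkew α ε i j
  skew i j = proj₂ (proj₂ shape i j)

  at-skew : ∀ r j → at T r j ≢ 0 → ρ α r ≤ j × j < ρ ε r
  at-skew r j ≢0 with at-cell T r j ≢0
  ... | i , j′ , refl , refl with skew i j′ (≢0 ∘ trans (at-entry T i j′))
  ...   | α≤j , j<ε = subst (_≤ _) (sym (ρ-toℕ α i)) α≤j , subst (_ <_) (sym (ρ-toℕ ε i)) j<ε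

  at-strict : ∀ r r′ j → r < r′ → at T r j ≢ 0 → at T r′ j ≢ 0 → at T r j < at T r′ j
  at-strict r r′ j r<r′ ≢0 ≢0′ with at-cell T r j ≢0 | at-cell T r′ j ≢0′
  ... | i , j₁ , refl , refl | i′ , j₂ , refl , j≡ with toℕ-injective j≡
  ...   | refl =
    subst₂ _<_ (sym (at-entry T i j₁)) (sym (at-entry T i′ j₁))
      (strict i i′ j₁ r<r′ (skew i j₁ (≢0 ∘ trans (at-entry T i j₁))) (skew i′ j₁ (≢0′ ∘ trans (at-entry T i′ j₁))))

  occ<-content : ∀ i → i < l → occ< T (suc i) l ≡ ρ β i
  occ<-content i i<l with index< i<l
  ... | r , refl = trans (sym (count-word (suc i) T)) (trans (content r) (sym (ρ-toℕ β r)))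

  -- Rows increase weakly, so in row `r` the letters `x + 2` are read before the letters `x + 1`.
  -- The lattice condition is applied to a prefix that ends between the two groups.
  occ<-step : ∀ x r → x < l → r < l → occ< T (suc (suc x)) (suc r) ≤ occ< T (suc x) r
  occ<-step x r x<l r<l with index< x<l | index< r<l
  ... | i , refl | r′ , refl
    with word-split T r′ | rowWord-split {x = suc (suc (toℕ i))} {suc (toℕ i)} 1+n≢n (lookup T r′) separated
    where
    separated : ∀ j j′ → j Fin.< j′ → toℕ (lookup (lookup T r′) j) ≡ suc (suc (toℕ i)) →
                toℕ (lookup (lookup T r′) j′) ≢ suc (toℕ i)
    separated j j′ j<j′ p q = 1+n≰n (subst₂ _≤_ p q (weak r′ j j′ j<j′
      (skew r′ j λ z → 1+n≢0 (trans (sym p) z)) (skew r′ j′ λ z → 1+n≢0 (trans (sym q) z))))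
  ... | us , ws , eq , cnt | ps , ss , eq′ , all , none = begin
    occ< T y r + occ T y r                ≡⟨ cong (occ< T y r +_) row-count ⟨
    occ< T y r + count y ps               ≡⟨ cong (_+ count y ps) (cnt y) ⟨
    count y us + count y ps               ≡⟨ count-++ y us ps ⟨
    count y (us ++ ps)                    ≤⟨ inits⁻ (us ++ ps) (ss ++ ws) (subst (All _ ∘ inits) split lattice) i ⟩
    count (suc x) (us ++ ps)              ≡⟨ count-++ (suc x) us ps ⟩
    count (suc x) us + count (suc x) ps   ≡⟨ cong₂ _+_ (cnt (suc x)) none ⟩
    occ< T (suc x) r + 0                  ≡⟨ +-identityʳ _ ⟩
    occ< T (suc x) r                      ∎
    where
    open ≤-Reasoning
    y = suc (suc x)
    row-count : count y ps ≡ occ T y r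
    row-count = trans all (trans (count-rowWord y (lookup T r′))
      (∑-cong k λ j _ → cong (λ z → ⟦ y ≟ z ⟧) (sym (ext-toℕ (λ i → rowAt (lookup T i) j) r′))))
    split : word T ≡ (us ++ ps) ++ (ss ++ ws)
    split = trans eq (trans (cong (λ v → us ++ v ++ ws) eq′)
      (trans (cong (us ++_) (++-assoc ps ss ws)) (sym (++-assoc us ps _))))

  occ<-descend : ∀ d x r → d + x < l → d + r ≤ l → occ< T (suc (d + x)) (d + r) ≤ occ< T (suc x) r
  occ<-descend zero    x r _ _ = ≤-refl
  occ<-descend (suc d) x r p q =
    ≤-trans (occ<-step (d + x) (d + r) (<-trans ≤-refl p) q) (occ<-descend d x r (<-trans ≤-refl p) (<⇒≤ q))

  -- Equal letters lie in distinct columns, here between ρ α q and ρ ε p.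
  occ<-strip : ∀ x p q → p ≤ q → occ< T (suc x) (suc q) + ρ α q ≤ occ< T (suc x) p + ρ ε p
  occ<-strip x p q p≤q = begin
    occ< T (suc x) (suc q) + ρ α q                        ≡⟨ cong (λ n → occ< T (suc x) n + ρ α q) (m∸n+n≡m (m≤n⇒m≤1+n p≤q)) ⟨
    occ< T (suc x) (d + p) + ρ α q                        ≡⟨ cong (_+ ρ α q) (∑-shift p d (occ T (suc x))) ⟩
    occ< T (suc x) p + strip + ρ α q                      ≡⟨ +-assoc (occ< T (suc x) p) strip _ ⟩
    occ< T (suc x) p + (strip + ρ α q)                    ≤⟨ +-monoʳ-≤ _ bound ⟩
    occ< T (suc x) p + ρ ε p                              ∎
    where
    open ≤-Reasoning
    d = suc q ∸ p
    strip = ∑ d (λ r → occ T (suc x) (r + p))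
    hit? : ∀ j r → Dec (suc x ≡ at T (r + p) j)
    hit? j r = suc x ≟ at T (r + p) j
    at≢0 : ∀ {r j} → suc x ≡ at T r j → at T r j ≢ 0
    at≢0 p q = 1+n≢0 (trans p q)
    row≤q : ∀ {r} → r < d → r + p ≤ q
    row≤q {r} r<d = s≤s⁻¹ (subst (suc r + p ≤_) (m∸n+n≡m (m≤n⇒m≤1+n p≤q)) (+-monoˡ-≤ p r<d))
    hit-≥ : ∀ {j r} → r < d → suc x ≡ at T (r + p) j → ρ α q ≤ j
    hit-≥ {j} {r} r<d eq = ≤-trans (antitone (ρ-antitone α) (row≤q r<d)) (proj₁ (at-skew (r + p) j (at≢0 eq)))
    hit-< : ∀ {j r} → suc x ≡ at T (r + p) j → j < ρ ε p
    hit-< {j} {r} eq = <-≤-trans (proj₂ (at-skew (r + p) j (at≢0 eq))) (antitone (ρ-antitone ε) (m≤n+m p r))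
    -- A letter `x + 1` in these rows forces `ρ α q ≤ j < ρ ε p`, and strictness allows one per
    -- column. Summing over all columns gives `bound`.
    column : ∀ j → ∑ d (λ r → ⟦ hit? j r ⟧) + ⟦ j <? ρ α q ⟧ ≤ ⟦ j <? ρ ε p ⟧
    column j = by-cases (j <? ρ α q) (j <? ρ ε p)
      where
      once : ∑ d (λ r → ⟦ hit? j r ⟧) ≤ 1
      once = ∑-unique d (hit? j) λ r r′ r<r′ e e′ → <⇒≢
        (at-strict (r + p) (r′ + p) j (+-monoˡ-< p r<r′) (at≢0 e) (at≢0 e′)) (trans (sym e) e′)
      by-cases : (u? : Dec (j < ρ α q)) (v? : Dec (j < ρ ε p)) → ∑ d (λ r → ⟦ hit? j r ⟧) + ⟦ u? ⟧ ≤ ⟦ v? ⟧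
      by-cases (yes j<α) (yes _)  = ≤-reflexive (cong (_+ 1) (∑-zero d λ r r<d →
        ⟦⟧-no (hit? j r) λ e → <⇒≱ j<α (hit-≥ r<d e)))
      by-cases (yes j<α) (no j≮ε) =
        contradiction (<-≤-trans j<α (≤-trans (antitone (ρ-antitone α) p≤q) (α≤ε p))) j≮ε
      by-cases (no _)    (yes _)  = ≤-trans (≤-reflexive (+-identityʳ _)) once
      by-cases (no _)    (no j≮ε) = ≤-reflexive (cong (_+ 0) (∑-zero d λ r r<d →
        ⟦⟧-no (hit? j r) λ e → j≮ε (hit-< e)))
    bound : strip + ρ α q ≤ ρ ε p
    bound = begin
      strip + ρ α q                                       ≡⟨ cong₂ _+_ (∑-swap d k λ r j → ⟦ hit? j r ⟧) (sym (∑-initial k (ρ≤k α q))) ⟩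
      ∑ k (λ j → ∑ d (λ r → ⟦ hit? j r ⟧)) + ∑ k (λ j → ⟦ j <? ρ α q ⟧)  ≡⟨ ∑-+ k _ _ ⟨
      ∑ k (λ j → ∑ d (λ r → ⟦ hit? j r ⟧) + ⟦ j <? ρ α q ⟧) ≤⟨ ∑-mono k (λ j _ → column j) ⟩
      ∑ k (λ j → ⟦ j <? ρ ε p ⟧)                          ≡⟨ ∑-initial k (ρ≤k ε p) ⟩
      ρ ε p                                               ∎

  -- By `d = l − a − 1` lattice steps, the `ρ β b` letters `b + 1` are at most as many as the
  -- letters `e + 1` in rows `0 … a`. The latter all lie in rows `e … a`, in distinct columns
  -- between `ρ α a` and `ρ ε e`.
  ε-upper : ∀ a b e → a < l → b < l → suc (a + b) ≡ l + e → ρ α a + ρ β b ≤ ρ ε e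
  ε-upper a b e a<l b<l a+b≡l+e = begin
    ρ α a + ρ β b                         ≡⟨ +-comm (ρ α a) _ ⟩
    ρ β b + ρ α a                         ≡⟨ cong (_+ ρ α a) (occ<-content b b<l) ⟨
    occ< T (suc b) l + ρ α a              ≡⟨ cong₂ (λ x n → occ< T (suc x) n + ρ α a) d+e≡b d+a≡l ⟨
    occ< T (suc (d + e)) (d + suc a) + ρ α a
      ≤⟨ +-monoˡ-≤ _ (occ<-descend d e (suc a) (subst (_< l) (sym d+e≡b) b<l) (≤-reflexive d+a≡l)) ⟩
    occ< T (suc e) (suc a) + ρ α a        ≤⟨ occ<-strip e e a e≤a ⟩
    -- A letter `e + 1` never stands above row `e`: `e` lattice steps lead to the letters 1 in no
    -- rows at all.
    occ< T (suc e) e + ρ ε e              ≡⟨ cong (λ n → occ< T (suc n) n + ρ ε e) (+-identityʳ e) ⟨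
    occ< T (suc (e + 0)) (e + 0) + ρ ε e
      ≤⟨ +-monoˡ-≤ _ (occ<-descend e 0 0 (subst (_< l) (sym (+-identityʳ e)) (≤-<-trans e≤a a<l))
                      (subst (_≤ l) (sym (+-identityʳ e)) (<⇒≤ (≤-<-trans e≤a a<l)))) ⟩
    ρ ε e                                 ∎
    where
    open ≤-Reasoning
    d = l ∸ suc a
    d+a≡l : d + suc a ≡ l
    d+a≡l = m∸n+n≡m a<l
    d+e≡b : d + e ≡ b
    d+e≡b = +-cancelˡ-≡ (suc a) (d + e) b (trans (sym (+-assoc (suc a) d e))
      (trans (cong (_+ e) (trans (+-comm (suc a) d) d+a≡l)) (sym a+b≡l+e)))
    e≤a : e ≤ a
    e≤a = +-cancelˡ-≤ l e a (subst (_≤ l + a) a+b≡l+e (≤-trans (≤-reflexive (cong suc (+-comm a b))) (+-monoˡ-≤ a b<l)))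

  -- The letters `b + 1` are split at row `c = a + b + 1`. Those from row `c` on occupy distinct
  -- columns before `ρ ε c`. Those above are, by `b` lattice steps, at most as many as the letters 1
  -- in rows `0 … a`, which fit beside `ρ α a` into the first row of `ε`.
  ε-lower : ∀ a b → suc (a + b) < l → ρ α a + ρ β b ≤ k + ρ ε (suc (a + b))
  ε-lower a b a+b<l = begin
    ρ α a + ρ β b                               ≡⟨ cong (ρ α a +_) (occ<-content b b<l) ⟨
    ρ α a + occ< T (suc b) l                    ≤⟨ +-monoʳ-≤ (ρ α a) below ⟩
    ρ α a + (occ< T (suc b) (b + suc a) + ρ ε c)  ≡⟨ +-assoc (ρ α a) _ _ ⟨
    ρ α a + occ< T (suc b) (b + suc a) + ρ ε c  ≤⟨ +-monoˡ-≤ (ρ ε c) above ⟩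
    k + ρ ε c                                   ∎
    where
    open ≤-Reasoning
    c = suc (a + b)
    c≡ : b + suc a ≡ c
    c≡ = trans (+-suc b a) (cong suc (+-comm b a))
    l≡ : suc (pred l) ≡ l
    l≡ = suc-pred l {{>-nonZero (≤-<-trans z≤n a+b<l)}}
    b<l : b < l
    b<l = ≤-<-trans (≤-trans (m≤n+m b a) (n≤1+n _)) a+b<l
    below : occ< T (suc b) l ≤ occ< T (suc b) (b + suc a) + ρ ε c
    below = begin
      occ< T (suc b) l                          ≡⟨ cong (occ< T (suc b)) l≡ ⟨
      occ< T (suc b) (suc (pred l))             ≤⟨ m≤m+n _ _ ⟩
      occ< T (suc b) (suc (pred l)) + ρ α (pred l)
        ≤⟨ occ<-strip b c (pred l) (s≤s⁻¹ (subst (suc c ≤_) (sym l≡) a+b<l)) ⟩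
      occ< T (suc b) c + ρ ε c                  ≡⟨ cong (λ n → occ< T (suc b) n + ρ ε c) c≡ ⟨
      occ< T (suc b) (b + suc a) + ρ ε c        ∎
    above : ρ α a + occ< T (suc b) (b + suc a) ≤ k
    above = begin
      ρ α a + occ< T (suc b) (b + suc a)        ≡⟨ cong (λ x → ρ α a + occ< T (suc x) (b + suc a)) (+-identityʳ b) ⟨
      ρ α a + occ< T (suc (b + 0)) (b + suc a)
        ≤⟨ +-monoʳ-≤ (ρ α a) (occ<-descend b 0 (suc a) (subst (_< l) (sym (+-identityʳ b)) b<l) (≤-trans (≤-reflexive c≡) (<⇒≤ a+b<l))) ⟩
      ρ α a + occ< T 1 (suc a)                  ≡⟨ +-comm (ρ α a) _ ⟩
      occ< T 1 (suc a) + ρ α a                  ≤⟨ occ<-strip 0 0 a z≤n ⟩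
      ρ ε 0                                     ≤⟨ ρ≤k ε 0 ⟩
      k                                         ∎

-- Necessity of the conditions

Contains : (ℕ → ℕ) → ℕ → ℕ → Set
Contains f a A = ∀ r → r < a → A ≤ f r

-- The source of the alternatives in the conditions: `Contains` puts no bound on the width, so a
-- rectangle wider than `k` must have no rows.
fits : (α : Young l k) → ∀ {a A} → Contains (ρ α) a A → a ≡ 0 ⊎ A ≤ k
fits α {zero}  ⊇ = inj₁ refl
fits α {suc a} ⊇ = inj₂ (≤-trans (⊇ 0 (s≤s z≤n)) (ρ≤k α 0))

module _ {l k : ℕ} {α β ε : Young l k} (τ : LRTableau α β ε) where

  -- `ε-upper` at the last rows of the two rectangles bounds row `e`, the last of the `a + b − l`
  -- rows claimed; the rows above it are at least as long.
  contains-sum : ∀ {a b A B} → a ≤ l → b ≤ l → Contains (ρ α) a A → Contains (ρ β) b B →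
                 Contains (ρ ε) (a + b ∸ l) (A + B)
  contains-sum {zero}  {b}     a≤l b≤l ⊇α ⊇β r r<e = contradiction (subst (r <_) (m≤n⇒m∸n≡0 b≤l) r<e) n≮0
  contains-sum {suc a} {zero}  a≤l b≤l ⊇α ⊇β r r<e =
    contradiction (subst (r <_) (trans (cong (_∸ l) (+-identityʳ _)) (m≤n⇒m∸n≡0 a≤l)) r<e) n≮0
  contains-sum {suc a} {suc b} {A} {B} a≤l b≤l ⊇α ⊇β r r<e = begin
    A + B           ≤⟨ +-mono-≤ (⊇α a ≤-refl) (⊇β b ≤-refl) ⟩
    ρ α a + ρ β b   ≤⟨ ε-upper τ a b e a≤l b≤l rows ⟩
    ρ ε e           ≤⟨ antitone (ρ-antitone ε) (s≤s⁻¹ (subst (suc r ≤_) (sym e+1≡) r<e)) ⟩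
    ρ ε r           ∎
    where
    open ≤-Reasoning
    e = pred (suc a + suc b ∸ l)
    e+1≡ : suc e ≡ suc a + suc b ∸ l
    e+1≡ = suc-pred (suc a + suc b ∸ l) {{>-nonZero (≤-<-trans z≤n r<e)}}
    l≤ : l ≤ suc a + suc b
    l≤ = <⇒≤ (≰⇒> λ le → n≮0 (subst (r <_) (m≤n⇒m∸n≡0 le) r<e))
    rows : suc (a + b) ≡ l + e
    rows = suc-injective (trans (cong suc (sym (+-suc a b)))
      (trans (sym (m+[n∸m]≡n l≤)) (trans (cong (l +_) (sym e+1≡)) (+-suc l e))))
  contains-α : ∀ {a A} → Contains (ρ α) a A → Contains (ρ ε) a A
  contains-α ⊇α r r<a = ≤-trans (⊇α r r<a) (α≤ε τ r)

  -- Containment of `β` in `ε` is not part of the definition of a tableau; it is `contains-sum` for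
  -- a rectangle of width 0 with `l` rows inside `α`.
  contains-β : ∀ {b B} → b ≤ l → Contains (ρ β) b B → Contains (ρ ε) b B
  contains-β {b} {B} b≤l ⊇β =
    subst (λ n → Contains (ρ ε) n B) (m+n∸m≡n l b) (contains-sum {A = 0} ≤-refl b≤l (λ _ _ → z≤n) ⊇β)

  -- `ε-lower` at the last rows of the two rectangles. If one of them has no rows, the other is
  -- already at least `A + B ∸ k` wide.
  contains-stack : ∀ {a b A B} → a + b ≤ l → A ≤ k → B ≤ k → Contains (ρ α) a A → Contains (ρ β) b B →
                   Contains (ρ ε) (a + b) (A + B ∸ k)
  contains-stack {zero} {b} {A} {B} a+b≤l A≤k B≤k ⊇α ⊇β r r<b =
    ≤-trans (m≤n+o⇒m∸n≤o (A + B) k (+-monoˡ-≤ B A≤k)) (contains-β a+b≤l ⊇β r r<b)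
  contains-stack {suc a} {zero} {A} {B} a+b≤l A≤k B≤k ⊇α ⊇β r r<a =
    ≤-trans (m≤n+o⇒m∸n≤o (A + B) k (≤-trans (+-monoʳ-≤ A B≤k) (≤-reflexive (+-comm A k))))
            (contains-α ⊇α r (subst (r <_) (+-identityʳ _) r<a))
  contains-stack {suc a} {suc b} {A} {B} a+b≤l A≤k B≤k ⊇α ⊇β r r<a+b = begin
    A + B ∸ k            ≤⟨ m≤n+o⇒m∸n≤o (A + B) k (≤-trans (+-mono-≤ (⊇α a ≤-refl) (⊇β b ≤-refl)) (ε-lower τ a b a+b<l)) ⟩
    ρ ε (suc (a + b))    ≤⟨ antitone (ρ-antitone ε) (subst (r ≤_) (+-suc a b) (s≤s⁻¹ r<a+b)) ⟩
    ρ ε r                ∎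
    where
    open ≤-Reasoning
    a+b<l : suc (a + b) < l
    a+b<l = subst (_< l) (+-suc a b) a+b≤l

  disjoint : ∀ {a b A B} → a ≤ l → b ≤ l → Contains (ρ α) a A → Contains (ρ β) b B → a + b ≤ l ⊎ A + B ≤ k
  disjoint {a} {b} a≤l b≤l ⊇α ⊇β = map₁ (m∸n≡0⇒m≤n {a + b} {l}) (fits ε (contains-sum a≤l b≤l ⊇α ⊇β))

Conditions : (l k a b c A B C : ℕ) → Set
Conditions l k a b c A B C =
    (a + b ≤ l ⊎ A + B ≤ k)
  × (a + c ≤ l ⊎ A + C ≤ k)
  × (b + c ≤ l ⊎ B + C ≤ k)
  × (a + b + c ≤ l ⊎ A + B + C ≤ 2 * k)
  × (a + b + c ≤ 2 * l ⊎ A + B + C ≤ k)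

m+n≤2*o : ∀ {m n o} → m ≤ o → n ≤ o → m + n ≤ 2 * o
m+n≤2*o {o = o} m≤o n≤o = +-mono-≤ m≤o (≤-trans n≤o (≤-reflexive (sym (+-identityʳ o))))

m∸n+o≤n⇒m+o≤2*n : ∀ m n o → m ∸ n + o ≤ n → m + o ≤ 2 * n
m∸n+o≤n⇒m+o≤2*n m n o h = begin
  m + o                  ≤⟨ +-monoˡ-≤ o (m≤n+m∸n m n) ⟩
  n + (m ∸ n) + o        ≡⟨ +-assoc n (m ∸ n) o ⟩
  n + (m ∸ n + o)        ≤⟨ +-monoʳ-≤ n h ⟩
  n + n                  ≤⟨ m+n≤2*o (≤-refl {n}) ≤-refl ⟩
  2 * n                  ∎
  where open ≤-Reasoning

necessary : ∀ {α β γ ε δ : Young l k} → LRTableau α β ε → LRTableau ε γ δ →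
  ∀ {a b c A B C} → a ≤ l → b ≤ l → c ≤ l → A ≤ k → B ≤ k → C ≤ k →
  Contains (ρ α) a A → Contains (ρ β) b B → Contains (ρ γ) c C → Conditions l k a b c A B C
necessary {l} {k} τ τ′ {a} {b} {c} {A} {B} {C} a≤l b≤l c≤l A≤k B≤k C≤k ⊇α ⊇β ⊇γ =
    i
  , disjoint τ′ a≤l c≤l (contains-α τ ⊇α) ⊇γ
  , disjoint τ′ b≤l c≤l (contains-β τ b≤l ⊇β) ⊇γ
  , iv
  , map₁ (m∸n+o≤n⇒m+o≤2*n (a + b) l c)
         (disjoint τ′ e≤l c≤l (contains-sum τ a≤l b≤l ⊇α ⊇β) ⊇γ)
  where
  i : a + b ≤ l ⊎ A + B ≤ k
  i = disjoint τ a≤l b≤l ⊇α ⊇β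
  e≤l : a + b ∸ l ≤ l
  e≤l = m≤n+o⇒m∸n≤o (a + b) l (+-mono-≤ a≤l b≤l)
  iv : a + b + c ≤ l ⊎ A + B + C ≤ 2 * k
  -- `contains-stack` takes `a + b ≤ l`. The other alternative of (i), with `C ≤ k`, bounds
  -- `A + B + C` directly.
  iv with i
  ... | inj₂ A+B≤k = inj₂ (m+n≤2*o A+B≤k C≤k)
  ... | inj₁ a+b≤l = map₂ (m∸n+o≤n⇒m+o≤2*n (A + B) k C)
    (disjoint τ′ a+b≤l c≤l (contains-stack τ a+b≤l A≤k B≤k ⊇α ⊇β) ⊇γ)

-- Tableaux with prescribed numbers of letters

∑-ones : ∀ n {f} → (∀ i → i < n → f i ≡ 1) → ∑ n f ≡ n
∑-ones zero    eq = refl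
∑-ones (suc n) eq = trans (cong₂ _+_ (∑-ones n λ i i<n → eq i (m<n⇒m<1+n i<n)) (eq n ≤-refl)) (+-comm n 1)

∑≤n : ∀ n {f} → (∀ i → f i ≤ 1) → ∑ n f ≤ n
∑≤n n le = ≤-trans (∑-mono n λ i _ → le i) (≤-reflexive (∑-ones n {λ _ → 1} λ _ _ → refl))

module _ {g : ℕ → ℕ} (g-step : ∀ i → g i ≤ g (suc i)) where

  monotone : ∀ {i i′} → i ≤ i′ → g i ≤ g i′
  monotone {i} i≤i′ = go (≤⇒≤′ i≤i′)
    where
    go : ∀ {i′} → i ≤′ i′ → g i ≤ g i′
    go (≤′-reflexive refl) = ≤-refl
    go (≤′-step p)         = ≤-trans (go p) (g-step _)

  -- As `g` is weakly increasing, the indices with `g i ≤ j` form an initial segment, so their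
  -- number tells on which side of `g i` the column `j` lies.
  ∑-below-> : ∀ {n i j} → i < n → g i ≤ j → i < ∑ n (λ i → ⟦ g i ≤? j ⟧)
  ∑-below-> {n} {i} {j} i<n gi≤j = ≤-trans
    (≤-reflexive (sym (∑-ones (suc i) λ i′ i′<1+i → ⟦⟧-yes (g i′ ≤? j) (≤-trans (monotone (s≤s⁻¹ i′<1+i)) gi≤j))))
    (∑-monoˡ _ i<n)

  ∑-below-≤ : ∀ n {i j} → j < g i → ∑ n (λ i → ⟦ g i ≤? j ⟧) ≤ i
  ∑-below-≤ n {i} {j} j<gi = begin
    ∑ n below                                        ≤⟨ ∑-monoˡ below (m≤n+m n i) ⟩
    ∑ (i + n) below                                  ≡⟨ cong (λ m → ∑ m below) (+-comm i n) ⟩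
    ∑ (n + i) below                                  ≡⟨ ∑-shift i n below ⟩
    ∑ i below + ∑ n (λ i′ → below (i′ + i))          ≡⟨ cong (∑ i below +_) (∑-zero n λ i′ _ → ⟦⟧-no (g (i′ + i) ≤? j)
                                                          (<⇒≱ (<-≤-trans j<gi (monotone (m≤n+m i i′))))) ⟩
    ∑ i below + 0                                    ≡⟨ +-identityʳ _ ⟩
    ∑ i below                                        ≤⟨ ∑≤n i (λ i′ → ⟦⟧≤1 (g i′ ≤? j)) ⟩
    i                                                ∎
    where
    open ≤-Reasoning
    below : ℕ → ℕ
    below i = ⟦ g i ≤? j ⟧

-- t r i is the number of letters i + 1 in row r of a tableau with inner shape f.
record Pattern (f : ℕ → ℕ) (t : ℕ → ℕ → ℕ) : Set where
  field
    -- Column strictness: the letters up to `i + 1` of row `r + 1` end no further right than the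
    -- letters up to `i` of row `r`.
    column  : ∀ r i → f (suc r) + ∑ (suc i) (t (suc r)) ≤ f r + ∑ i (t r)
    lattice : ∀ r i → ∑ (suc r) (λ q → t q (suc i)) ≤ ∑ r (λ q → t q i)

module _ {f : ℕ → ℕ} {t : ℕ → ℕ → ℕ} (pat : Pattern f t) {l k : ℕ} {α β ε : Young l k}
         (α≡ : ∀ i → row α i ≡ f (toℕ i))
         (β≡ : ∀ i → row β i ≡ ∑ l (λ r → t r (toℕ i)))
         (ε≡ : ∀ i → row ε i ≡ f (toℕ i) + ∑ l (t (toℕ i))) where

  open Pattern pat

  private
    -- The end of the letters ≤ i in row r.
    g : ℕ → ℕ → ℕ
    g r i = f r + ∑ i (t r)

    g-step : ∀ r i → g r i ≤ g r (suc i)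
    g-step r i = +-monoʳ-≤ (f r) (m≤m+n _ (t r i))

    g-diagonal : ∀ {r r′} i → r < r′ → g r′ (suc i) ≤ g r i
    g-diagonal {r} i r<r′ = go (≤⇒≤′ r<r′)
      where
      go : ∀ {r′} → suc r ≤′ r′ → g r′ (suc i) ≤ g r i
      go (≤′-reflexive refl)   = column r i
      go (≤′-step {n = r′} p) = ≤-trans (column r′ i) (≤-trans (g-step r′ i) (go p))

    -- The letter in column `j` is the number of blocks starting at or before `j`. This is 0 in the
    -- inner shape, since the first block starts at `g r 0 = f r`; the cells from `g r l` on are
    -- emptied explicitly.
    value : ℕ → ℕ → ℕ
    value r j = if does (j <? g r l) then ∑ l (λ i → ⟦ g r i ≤? j ⟧) else 0

    value-in : ∀ r j → j < g r l → value r j ≡ ∑ l (λ i → ⟦ g r i ≤? j ⟧)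
    value-in r j j<g rewrite dec-true (j <? g r l) j<g = refl

    value-out : ∀ r j → g r l ≤ j → value r j ≡ 0
    value-out r j g≤j rewrite dec-false (j <? g r l) (≤⇒≯ g≤j) = refl

    value-≤ : ∀ r i j → j < g r i → value r j ≤ i
    value-≤ r i j j<g with j <? g r l
    ... | yes p = subst (_≤ i) (sym (value-in r j p)) (∑-below-≤ (g-step r) l j<g)
    ... | no ¬p = subst (_≤ i) (sym (value-out r j (≮⇒≥ ¬p))) z≤n

    value-> : ∀ r i j → j < g r l → g r i ≤ j → i < value r j
    value-> r i j j<g g≤j = subst (i <_) (sym (value-in r j j<g)) (∑-below-> (g-step r) i<l g≤j)
      where
      i<l : i < l
      i<l = ≰⇒> λ l≤i → <⇒≱ j<g (≤-trans (monotone (g-step r) l≤i) g≤j)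

    value≤l : ∀ r j → value r j ≤ l
    value≤l r j with j <? g r l
    ... | yes p = value-≤ r l j p
    ... | no ¬p = subst (_≤ l) (sym (value-out r j (≮⇒≥ ¬p))) z≤n

    letter : Fin l → Fin k → Fin (suc l)
    letter i j = fromℕ< (s≤s (value≤l (toℕ i) (toℕ j)))

    T : Filling l k
    T = tabulate λ i → tabulate (letter i)

    T-entry : ∀ i j → entry T i j ≡ value (toℕ i) (toℕ j)
    T-entry i j = trans
      (cong toℕ (trans (cong (λ v → lookup v j) (lookup∘tabulate (λ i → tabulate (letter i)) i)) (lookup∘tabulate (letter i) j)))
      (toℕ-fromℕ< (s≤s (value≤l (toℕ i) (toℕ j))))

    T-at : ∀ r j → r < l → j < k → at T r j ≡ value r j
    T-at r j r<l j<k with index< r<l | index< j<k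
    ... | i , refl | j′ , refl = trans (at-entry T i j′) (T-entry i j′)

    g₀ : ∀ i → row α i ≡ g (toℕ i) 0
    g₀ i = trans (α≡ i) (sym (+-identityʳ _))

    g≤k : ∀ {r i} → r < l → i ≤ l → g r i ≤ k
    g≤k {r} {i} r<l i≤l with index< r<l
    ... | j , refl = ≤-trans (monotone (g-step (toℕ j)) i≤l) (subst (_≤ k) (ε≡ j) (s≤s⁻¹ (toℕ<n (lookup (parts ε) j))))

    -- The letters `i + 1` fill the columns from `g r i` up to `g r (i + 1)`. Counting them together
    -- with all columns before `g r i` avoids a subtraction.
    T-occ : ∀ r i → r < l → i < l → occ T (suc i) r ≡ t r i
    T-occ r i r<l i<l = +-cancelʳ-≡ (g r i) (occ T (suc i) r) (t r i) (begin
      occ T (suc i) r + g r i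
        ≡⟨ cong (occ T (suc i) r +_) (∑-initial k (g≤k r<l (<⇒≤ i<l))) ⟨
      occ T (suc i) r + ∑ k (λ j → ⟦ j <? g r i ⟧)
        ≡⟨ ∑-+ k _ _ ⟨
      ∑ k (λ j → ⟦ suc i ≟ at T r j ⟧ + ⟦ j <? g r i ⟧)
        ≡⟨ ∑-cong k (λ j j<k → trans (cong (λ v → ⟦ suc i ≟ v ⟧ + _) (T-at r j r<l j<k)) (cell j)) ⟩
      ∑ k (λ j → ⟦ j <? g r (suc i) ⟧)
        ≡⟨ ∑-initial k (g≤k r<l i<l) ⟩
      f r + (∑ i (t r) + t r i)
        ≡⟨ +-assoc (f r) _ _ ⟨
      g r i + t r i
        ≡⟨ +-comm (g r i) _ ⟩
      t r i + g r i ∎)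
      where
      open ≡-Reasoning
      cell : ∀ j → ⟦ suc i ≟ value r j ⟧ + ⟦ j <? g r i ⟧ ≡ ⟦ j <? g r (suc i) ⟧
      cell j = by-cases (j <? g r i) (j <? g r (suc i))
        where
        by-cases : (p? : Dec (j < g r i)) (q? : Dec (j < g r (suc i))) → ⟦ suc i ≟ value r j ⟧ + ⟦ p? ⟧ ≡ ⟦ q? ⟧
        by-cases (yes p) (yes _) = cong (_+ 1) (⟦⟧-no (suc i ≟ value r j) λ e → 1+n≰n (subst (_≤ i) (sym e) (value-≤ r i j p)))
        by-cases (yes p) (no ¬q) = contradiction (<-≤-trans p (g-step r i)) ¬q
        by-cases (no ¬p) (yes q) = cong (_+ 0) (⟦⟧-yes (suc i ≟ value r j) (≤-antisym
          (value-> r i j (<-≤-trans q (monotone (g-step r) i<l)) (≮⇒≥ ¬p)) (value-≤ r (suc i) j q)))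
        by-cases (no ¬p) (no ¬q) = cong (_+ 0) (⟦⟧-no (suc i ≟ value r j) other)
          where
          other : suc i ≢ value r j
          other e with j <? g r l
          ... | yes p = 1+n≰n (subst (suc (suc i) ≤_) (sym e) (value-> r (suc i) j p (≮⇒≥ ¬q)))
          ... | no ¬r = 1+n≢0 (trans e (value-out r j (≮⇒≥ ¬r)))

    T-occ-large : ∀ r x → r < l → l < x → occ T x r ≡ 0
    T-occ-large r x r<l l<x = ∑-zero k λ j j<k → ⟦⟧-no (x ≟ at T r j) λ e →
      <⇒≱ l<x (subst (_≤ l) (sym (trans e (T-at r j r<l j<k))) (value≤l r j))

    T-occ< : ∀ r i → r ≤ l → i < l → occ< T (suc i) r ≡ ∑ r (λ q → t q i)
    T-occ< r i r≤l i<l = ∑-cong r λ q q<r → T-occ q i (<-≤-trans q<r r≤l) i<l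

    T-lattice : ∀ r i → r < l → i < l → occ< T (suc (suc i)) (suc r) ≤ occ< T (suc i) r
    T-lattice r i r<l i<l with suc i <? l
    ... | yes 1+i<l = subst₂ _≤_ (sym (T-occ< (suc r) (suc i) r<l 1+i<l)) (sym (T-occ< r i (<⇒≤ r<l) i<l)) (lattice r i)
    -- The letter `i + 2` exceeds `l` and does not occur.
    ... | no  1+i≮l = ≤-trans (≤-reflexive (∑-zero (suc r) λ q q<1+r →
      T-occ-large q (suc (suc i)) (<-≤-trans q<1+r r<l) (s≤s (≮⇒≥ 1+i≮l)))) z≤n

    skew⇒ : ∀ i j → InSkew α ε i j → g (toℕ i) 0 ≤ toℕ j × toℕ j < g (toℕ i) l
    skew⇒ i j (α≤j , j<ε) = subst (_≤ _) (g₀ i) α≤j , subst (_ <_) (ε≡ i) j<ε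

    T-shape : HasShape α ε T
    T-shape = (λ i → subst₂ _≤_ (sym (g₀ i)) (sym (ε≡ i)) (monotone (g-step (toℕ i)) {0} {l} z≤n)) ,
              λ i j → (λ s z → n≮0 (subst (0 <_) (trans (sym (T-entry i j)) z) (let p , q = skew⇒ i j s in value-> (toℕ i) 0 (toℕ j) q p)))
                    , inSkew i j
      where
      inSkew : ∀ i j → entry T i j ≢ 0 → InSkew α ε i j
      inSkew i j ≢0 =
        subst (_≤ _) (sym (g₀ i)) (≮⇒≥ λ j<g → value≢0 (n≤0⇒n≡0 (value-≤ (toℕ i) 0 (toℕ j) j<g))) ,
        subst (_ <_) (sym (ε≡ i)) (≰⇒> λ g≤j → value≢0 (value-out (toℕ i) (toℕ j) g≤j))
        where
        value≢0 : value (toℕ i) (toℕ j) ≢ 0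
        value≢0 z = ≢0 (trans (T-entry i j) z)

    T-weak : RowsWeak α ε T
    -- If `v` is the letter in column `j′`, then `j′`, and with it `j`, lies before `g r v`.
    T-weak i j j′ j<j′ _ s′ = subst₂ _≤_ (sym (T-entry i j)) (sym (T-entry i j′)) (value-≤ (toℕ i) _ (toℕ j)
      (<-trans j<j′ (≰⇒> λ le → <-irrefl refl (value-> (toℕ i) _ (toℕ j′) (proj₂ (skew⇒ i j′ s′)) le))))

    T-strict : ColumnsStrict α ε T
    T-strict i i′ j i<i′ s s′ = subst₂ _<_ (sym (T-entry i j)) (sym (T-entry i′ j)) (go _ refl)
      where
      go : ∀ v → v ≡ value (toℕ i′) (toℕ j) → value (toℕ i) (toℕ j) < value (toℕ i′) (toℕ j)
      go zero    e = contradiction (subst (0 <_) (sym e) (let p , q = skew⇒ i′ j s′ in value-> (toℕ i′) 0 (toℕ j) q p)) n≮0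
      -- The column lies before the end of the letters up to `v + 1` in the lower row, hence by
      -- `g-diagonal` before the end of the letters up to `v` in the upper row.
      go (suc v) e = subst (value (toℕ i) (toℕ j) <_) e (s≤s (value-≤ (toℕ i) v (toℕ j) (<-≤-trans
        (≰⇒> λ le → <-irrefl e (value-> (toℕ i′) (suc v) (toℕ j) (proj₂ (skew⇒ i′ j s′)) le)) (g-diagonal v i<i′))))

    T-content : HasContent β T
    T-content i = trans (count-word (suc (toℕ i)) T) (trans (T-occ< l (toℕ i) ≤-refl (toℕ<n i)) (sym (β≡ i)))

    T-prefix : IsLattice T
    T-prefix = inits⁺ (readingWord T) λ us vs eq → go us (prefix-counts T us vs eq)
      where
      go : ∀ us → us ≡ [] ⊎ ∃[ r ] (r < l × ∀ x → occ< T x r ≤ count x us × count x us ≤ occ< T x (suc r)) →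
           ∀ (i : Fin l) → count (suc (suc (toℕ i))) us ≤ count (suc (toℕ i)) us
      go us (inj₁ refl)            i = z≤n
      -- The prefix has at most the letters `i + 2` of rows `0 … r` and at least the letters `i + 1`
      -- of the rows before `r`.
      go us (inj₂ (r , r<l , bnd)) i =
        ≤-trans (proj₂ (bnd _)) (≤-trans (T-lattice r (toℕ i) r<l (toℕ<n i)) (proj₁ (bnd _)))

  realise : LRTableau α β ε
  realise = lrTableau T (T-shape , T-weak , T-strict , T-content , T-prefix)

-- Adding a rectangle

box : ℕ → ℕ → ℕ → ℕ
box zero    A r       = 0
box (suc a) A zero    = A
box (suc a) A (suc r) = box a A r

box-< : ∀ {a} A {r} → r < a → box a A r ≡ A
box-< {suc a} A {zero}  _         = refl
box-< {suc a} A {suc r} (s≤s r<a) = box-< A r<a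

box-≥ : ∀ {a} A {r} → a ≤ r → box a A r ≡ 0
box-≥ {zero}  A         _         = refl
box-≥ {suc a} A {suc r} (s≤s a≤r) = box-≥ A a≤r

box-≤ : ∀ a A r → box a A r ≤ A
box-≤ zero    A r       = z≤n
box-≤ (suc a) A zero    = ≤-refl
box-≤ (suc a) A (suc r) = box-≤ a A r

box-antitone : ∀ a A → Antitone (box a A)
box-antitone zero    A r       = z≤n
box-antitone (suc a) A zero    = box-≤ a A 0
box-antitone (suc a) A (suc r) = box-antitone a A r

module Insertion (f : ℕ → ℕ) (f-antitone : Antitone f) (c C x : ℕ) (f≤ : f 0 ≤ x + C) where

  -- Indices are shifted by one: `height s` is the length of row `s − 1` of `f`, raised to at least
  -- `x`, and `height 0` is that of the imaginary row -1.
  height : ℕ → ℕ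
  height zero    = x + C
  height (suc s) = f s ⊔ x

  -- The letters i + 1 are spread over the rows i, i + 1, …, the number in row
  -- i + s depending on s only: it is the overhang of row s − 1 over row s of f,
  -- measured to the right of column x (row −1 having length x + C).
  insertion : ℕ → ℕ → ℕ
  insertion r i = if does (i <? c) then height (r ∸ i) ∸ height (suc r ∸ i) else 0

  height-step : Antitone height
  height-step zero    = ⊔-lub f≤ (m≤m+n x C)
  height-step (suc s) = ⊔-monoˡ-≤ x (f-antitone s)

  x≤height : ∀ s → x ≤ height s
  x≤height zero    = m≤m+n x C
  x≤height (suc s) = m≤n⊔m (f s) x

  insertion-< : ∀ r {i} → i < c → insertion r i ≡ height (r ∸ i) ∸ height (suc r ∸ i)
  insertion-< r {i} i<c rewrite dec-true (i <? c) i<c = refl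

  insertion-≥ : ∀ r {i} → c ≤ i → insertion r i ≡ 0
  insertion-≥ r {i} c≤i rewrite dec-false (i <? c) (≤⇒≯ c≤i) = refl

  height-∸ : ∀ r i → height (suc r ∸ i) ≤ height (r ∸ i)
  height-∸ r i = antitone height-step (∸-monoˡ-≤ i (n≤1+n r))

  -- The sum telescopes; the terms with `i > r` vanish, as truncated subtraction turns both heights
  -- into `height 0`.
  row-sum : ∀ r n → n ≤ c → ∑ n (insertion r) + height (suc r) ≡ height (suc r ∸ n)
  row-sum r zero    _   = refl
  row-sum r (suc n) n<c = begin
    ∑ n (insertion r) + insertion r n + height (suc r)      ≡⟨ +-assoc (∑ n (insertion r)) _ _ ⟩
    ∑ n (insertion r) + (insertion r n + height (suc r))    ≡⟨ cong (∑ n (insertion r) +_) (+-comm (insertion r n) _) ⟩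
    ∑ n (insertion r) + (height (suc r) + insertion r n)    ≡⟨ +-assoc (∑ n (insertion r)) _ _ ⟨
    ∑ n (insertion r) + height (suc r) + insertion r n      ≡⟨ cong₂ _+_ (row-sum r n (<⇒≤ n<c)) (insertion-< r n<c) ⟩
    height (suc r ∸ n) + (height (r ∸ n) ∸ height (suc r ∸ n)) ≡⟨ m+[n∸m]≡n (height-∸ r n) ⟩
    height (r ∸ n)                                          ∎
    where open ≡-Reasoning

  -- For a fixed letter the sum over the rows telescopes from `height 0 = x + C`, so all `C` copies
  -- are placed once the height has dropped to `x`.
  column-sum : ∀ n {i} → i < c → ∑ n (λ q → insertion q i) + height (n ∸ i) ≡ x + C
  column-sum zero    {i} i<c rewrite 0∸n≡0 i = refl
  column-sum (suc n) {i} i<c = begin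
    S + insertion n i + height (suc n ∸ i)                                 ≡⟨ +-assoc S _ _ ⟩
    S + (insertion n i + height (suc n ∸ i))                               ≡⟨ cong (λ m → S + (m + height (suc n ∸ i))) (insertion-< n i<c) ⟩
    S + (height (n ∸ i) ∸ height (suc n ∸ i) + height (suc n ∸ i))         ≡⟨ cong (S +_) (m∸n+n≡m (height-∸ n i)) ⟩
    S + height (n ∸ i)                                                     ≡⟨ column-sum n i<c ⟩
    x + C                                                                  ∎
    where
    open ≡-Reasoning
    S = ∑ n (λ q → insertion q i)

  column-sum-≤ : ∀ n i → ∑ n (λ q → insertion q i) ≤ C
  column-sum-≤ n i with i <? c
  ... | yes i<c = +-cancelʳ-≤ x _ C (≤-trans (+-monoʳ-≤ _ (x≤height (n ∸ i)))
                    (≤-reflexive (trans (column-sum n i<c) (+-comm x C))))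
  ... | no  i≮c = ≤-trans (≤-reflexive (∑-zero n λ q _ → insertion-≥ q (≮⇒≥ i≮c))) z≤n

  -- Both sides have the same difference of row and letter, so they agree while `i + 1 < c`.
  -- Comparing term by term in this way gives both conditions of `Pattern`.
  insertion-diagonal : ∀ r i → insertion (suc r) (suc i) ≤ insertion r i
  insertion-diagonal r i with suc i <? c
  ... | yes i+1<c = ≤-reflexive (trans (insertion-< (suc r) i+1<c) (sym (insertion-< r (<-trans ≤-refl i+1<c))))
  ... | no  i+1≮c = ≤-trans (≤-reflexive (insertion-≥ (suc r) (≮⇒≥ i+1≮c))) z≤n

  insertion-top : ∀ i → insertion 0 (suc i) ≡ 0
  insertion-top i with suc i <? c
  ... | yes i+1<c = trans (insertion-< 0 i+1<c) (m≤n⇒m∸n≡0 (≤-reflexive (cong height (sym (0∸n≡0 i)))))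
  ... | no  i+1≮c = insertion-≥ 0 (≮⇒≥ i+1≮c)

  -- Raising both rows to at least `x` can only shrink the overhang of row `r` over row `r + 1`.
  insertion-overhang : ∀ r → f (suc r) + insertion (suc r) 0 ≤ f r
  insertion-overhang r = begin
    f (suc r) + insertion (suc r) 0                     ≤⟨ +-monoʳ-≤ (f (suc r)) first ⟩
    f (suc r) + (height (suc r) ∸ height (suc (suc r))) ≤⟨ +-monoʳ-≤ (f (suc r)) (m≤n+o⇒m∸n≤o _ (f (suc r) ⊔ x) gap) ⟩
    f (suc r) + (f r ∸ f (suc r))                       ≡⟨ m+[n∸m]≡n (f-antitone r) ⟩
    f r                                                 ∎
    where
    open ≤-Reasoning
    first : insertion (suc r) 0 ≤ height (suc r) ∸ height (suc (suc r))
    first with 0 <? c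
    ... | yes 0<c = ≤-reflexive (insertion-< (suc r) 0<c)
    ... | no  0≮c = ≤-trans (≤-reflexive (insertion-≥ (suc r) (≮⇒≥ 0≮c))) z≤n
    gap : f r ⊔ x ≤ (f (suc r) ⊔ x) + (f r ∸ f (suc r))
    gap = ⊔-lub (≤-trans (m≤n+m∸n (f r) (f (suc r))) (+-monoˡ-≤ _ (m≤m⊔n (f (suc r)) x)))
                (≤-trans (m≤n⊔m (f (suc r)) x) (m≤m+n _ _))

  insertion-pattern : Pattern f insertion
  insertion-pattern = record
    { column = λ r i → begin
        f (suc r) + ∑ (suc i) (insertion (suc r))
          ≡⟨ cong (f (suc r) +_) (∑-front i (insertion (suc r))) ⟩
        f (suc r) + (insertion (suc r) 0 + ∑ i (insertion (suc r) ∘ suc))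
          ≡⟨ +-assoc (f (suc r)) _ _ ⟨
        f (suc r) + insertion (suc r) 0 + ∑ i (insertion (suc r) ∘ suc)
          ≤⟨ +-mono-≤ (insertion-overhang r) (∑-mono i λ j _ → insertion-diagonal r j) ⟩
        f r + ∑ i (insertion r) ∎
    ; lattice = λ r i → begin
        ∑ (suc r) (λ q → insertion q (suc i))
          ≡⟨ ∑-front r (λ q → insertion q (suc i)) ⟩
        insertion 0 (suc i) + ∑ r (λ q → insertion (suc q) (suc i))
          ≤⟨ +-mono-≤ (≤-reflexive (insertion-top i)) (∑-mono r λ q _ → insertion-diagonal q i) ⟩
        ∑ r (λ q → insertion q i) ∎
    }
    where open ≤-Reasoning

  module _ {l : ℕ} (c≤l : c ≤ l) where

    insertion-content : f (l ∸ c) ≤ x → ∀ i → ∑ l (λ q → insertion q i) ≡ box c C i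
    insertion-content fits i with i <? c
    ... | no  i≮c = trans (∑-zero l λ q _ → insertion-≥ q (≮⇒≥ i≮c)) (sym (box-≥ C (≮⇒≥ i≮c)))
    ... | yes i<c = trans (+-cancelʳ-≡ x _ C (trans (cong (∑ l _ +_) (sym bottom)) (trans (column-sum l i<c) (+-comm x C))))
                          (sym (box-< C i<c))
      where
      -- Since `i < c`, row `l − i − 1` is not above row `l − c`, where `f` is at most `x` already.
      bottom : height (l ∸ i) ≡ x
      bottom = trans (cong height (+-∸-assoc 1 (≤-trans i<c c≤l)))
        (m≤n⇒m⊔n≡n (≤-trans (antitone f-antitone (∸-monoʳ-≤ l i<c)) fits))

    insertion-row : ∀ r → ∑ l (insertion r) + (f r ⊔ x) ≡ height (suc r ∸ c)
    insertion-row r = trans (cong (_+ (f r ⊔ x)) restrict) (row-sum r c ≤-refl)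
      where
      restrict : ∑ l (insertion r) ≡ ∑ c (insertion r)
      restrict = begin
        ∑ l (insertion r)                ≡⟨ cong (λ n → ∑ n (insertion r)) (m∸n+n≡m c≤l) ⟨
        ∑ (l ∸ c + c) (insertion r)      ≡⟨ ∑-shift c (l ∸ c) (insertion r) ⟩
        ∑ c (insertion r) + ∑ (l ∸ c) (λ i → insertion r (i + c))
          ≡⟨ cong (∑ c (insertion r) +_) (∑-zero (l ∸ c) λ i _ → insertion-≥ r (m≤n+m c i)) ⟩
        ∑ c (insertion r) + 0            ≡⟨ +-identityʳ _ ⟩
        ∑ c (insertion r)                ∎
        where open ≡-Reasoning

-- The product of two rectangles

-- Puts a row with `B` letters 1 on top; the old rows move down by one and their letters go up by
-- one.
prepend : ℕ → (ℕ → ℕ → ℕ) → ℕ → ℕ → ℕ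
prepend B t zero    zero    = B
prepend B t zero    (suc i) = 0
prepend B t (suc r) zero    = 0
prepend B t (suc r) (suc i) = t r i

module _ (B : ℕ) (t : ℕ → ℕ → ℕ) where

  private
    t⁺ = prepend B t

  prepend-row-0 : ∀ n → ∑ (suc n) (t⁺ 0) ≡ B
  prepend-row-0 n = trans (∑-front n (t⁺ 0)) (trans (cong (B +_) (∑-zero n λ _ _ → refl)) (+-identityʳ B))

  prepend-row-suc : ∀ r n → ∑ (suc n) (t⁺ (suc r)) ≡ ∑ n (t r)
  prepend-row-suc r n = ∑-front n (t⁺ (suc r))

  prepend-column-0 : ∀ n → ∑ (suc n) (λ q → t⁺ q 0) ≡ B
  prepend-column-0 n = trans (∑-front n (λ q → t⁺ q 0)) (trans (cong (B +_) (∑-zero n λ _ _ → refl)) (+-identityʳ B))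

  prepend-column-suc : ∀ n i → ∑ (suc n) (λ q → t⁺ q (suc i)) ≡ ∑ n (λ q → t q i)
  prepend-column-suc n i = ∑-front n (λ q → t⁺ q (suc i))

  prepend-content : ∀ n b → (∀ i → ∑ n (λ q → t q i) ≡ box b B i) →
                    ∀ i → ∑ (suc n) (λ q → t⁺ q i) ≡ box (suc b) B i
  prepend-content n b eq zero    = prepend-column-0 n
  prepend-content n b eq (suc i) = trans (prepend-column-suc n i) (eq i)

  module _ (bounded : ∀ n i → ∑ n (λ q → t q i) ≤ B) where

    prepend-bounded : ∀ n i → ∑ n (λ q → t⁺ q i) ≤ B
    prepend-bounded zero    i       = z≤n
    prepend-bounded (suc n) zero    = ≤-reflexive (prepend-column-0 n)
    prepend-bounded (suc n) (suc i) = ≤-trans (≤-reflexive (prepend-column-suc n i)) (bounded n i)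

    prepend-pattern : ∀ {f} → f 1 ≤ f 0 → Antitone (f ∘ suc) → Pattern (f ∘ suc) t → Pattern f t⁺
    prepend-pattern {f} f₁≤f₀ f-antitone P = record { column = column⁺ ; lattice = lattice⁺ }
      where
      open Pattern P
      first-row : ∀ i → ∑ i (t 0) ≤ ∑ i (t⁺ 0)
      first-row zero    = z≤n
      first-row (suc i) = begin
        ∑ (suc i) (t 0)                ≡⟨ ∑-front i (t 0) ⟩
        -- With no rows above it, the first row contains only the letter 1, by the lattice
        -- condition.
        t 0 0 + ∑ i (t 0 ∘ suc)        ≡⟨ cong (t 0 0 +_) (∑-zero i λ j _ → n≤0⇒n≡0 (lattice 0 j)) ⟩
        t 0 0 + 0                      ≡⟨ +-identityʳ _ ⟩
        t 0 0                          ≤⟨ bounded 1 0 ⟩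
        B                              ≡⟨ prepend-row-0 i ⟨
        ∑ (suc i) (t⁺ 0)               ∎
        where open ≤-Reasoning
      column⁺ : ∀ r i → f (suc r) + ∑ (suc i) (t⁺ (suc r)) ≤ f r + ∑ i (t⁺ r)
      column⁺ zero    i       rewrite prepend-row-suc 0 i = +-mono-≤ f₁≤f₀ (first-row i)
      column⁺ (suc r) zero    = +-monoˡ-≤ 0 (f-antitone r)
      column⁺ (suc r) (suc i) rewrite prepend-row-suc (suc r) (suc i) | prepend-row-suc r i = column r i
      lattice⁺ : ∀ r i → ∑ (suc r) (λ q → t⁺ q (suc i)) ≤ ∑ r (λ q → t⁺ q i)
      lattice⁺ zero    zero    = z≤n
      lattice⁺ zero    (suc i) = z≤n
      lattice⁺ (suc r) zero    rewrite prepend-column-suc (suc r) 0 | prepend-column-0 r = bounded (suc r) 0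
      lattice⁺ (suc r) (suc i) rewrite prepend-column-suc (suc r) (suc i) | prepend-column-suc r i = lattice r i

-- By rows-≤, the possible row lengths are A + B, x + B, A, B, A − x and 0; the
-- first occurs only in the first e rows, and A − x only below both rectangles.
record RectangleProduct (l a b A B e x : ℕ) : Set where
  field
    numbers : ℕ → ℕ → ℕ
    isPattern : Pattern (box a A) numbers
    bounded : ∀ n i → ∑ n (λ q → numbers q i) ≤ B
    content : ∀ i → ∑ l (λ q → numbers q i) ≡ box b B i
    rows-≤  : ∀ p y → (p < e → A + B ≤ y) → (p < a → p < b → x + B ≤ y) → (p < a → A ≤ y) → (p < b → B ≤ y) →
              (p < a + b → A ≤ x + y) → box a A p + ∑ l (numbers p) ≤ y

-- Insertion of `b × B` into `a × A`. As `a + b ≤ l`, row `l − b` of the inner shape is empty, so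
-- all letters find room for any `x`. The position of `p` relative to `a` and `b` determines the row
-- length.
rectangleProduct-disjoint : ∀ l a b A B x → a + b ≤ l → x ≤ A → A ≤ x + B → RectangleProduct l a b A B 0 x
rectangleProduct-disjoint l a b A B x a+b≤l x≤A A≤x+B = record
  { numbers = insertion
  ; isPattern = insertion-pattern
  ; bounded = column-sum-≤
  ; content = insertion-content b≤l (≤-trans (≤-reflexive (box-≥ A (m+n≤o⇒m≤o∸n a a+b≤l))) z≤n)
  ; rows-≤  = rows
  }
  where
  open Insertion (box a A) (box-antitone a A) b B x (≤-trans (box-≤ a A 0) A≤x+B)
  b≤l : b ≤ l
  b≤l = m+n≤o⇒n≤o a a+b≤l
  rows : ∀ p y → (p < 0 → A + B ≤ y) → (p < a → p < b → x + B ≤ y) → (p < a → A ≤ y) → (p < b → B ≤ y) →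
         (p < a + b → A ≤ x + y) → box a A p + ∑ l (insertion p) ≤ y
  rows p y _ both onlyA onlyB above with p <? a | p <? b | insertion-row b≤l p
  ... | yes p<a | yes p<b | eq rewrite box-< A p<a | m≥n⇒m⊔n≡m x≤A | m≤n⇒m∸n≡0 p<b =
    ≤-trans (≤-reflexive (trans (+-comm A _) eq)) (both p<a p<b)
  ... | yes p<a | no  p≮b | eq rewrite box-< A p<a | m≥n⇒m⊔n≡m x≤A | +-∸-assoc 1 (≮⇒≥ p≮b) =
    ≤-trans (≤-reflexive (trans (+-comm A _) eq))
      (≤-trans (⊔-lub (box-≤ a A (p ∸ b)) x≤A) (onlyA p<a))
  ... | no  p≮a | yes p<b | eq rewrite box-≥ A (≮⇒≥ p≮a) | m≤n⇒m∸n≡0 p<b =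
    ≤-trans (≤-reflexive (+-cancelʳ-≡ x _ B (trans eq (+-comm x B)))) (onlyB p<b)
  -- Below both rectangles, row `p` is as long as the part of row `p − b` of `a × A` to the right of
  -- column `x`.
  ... | no  p≮a | no  p≮b | eq rewrite box-≥ A (≮⇒≥ p≮a) | +-∸-assoc 1 (≮⇒≥ p≮b) =
    +-cancelʳ-≤ x _ y (≤-trans (≤-reflexive eq) (⊔-lub overhang (m≤n+m x y)))
    where
    overhang : box a A (p ∸ b) ≤ y + x
    overhang with p ∸ b <? a
    ... | yes q = ≤-trans (box-≤ a A (p ∸ b)) (≤-trans (above (subst (_< a + b) (m∸n+n≡m (≮⇒≥ p≮b)) (+-monoˡ-< b q))) (≤-reflexive (+-comm x y)))
    ... | no ¬q = ≤-trans (≤-reflexive (box-≥ A (≮⇒≥ ¬q))) z≤n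

-- Each of the `e` forced rows of length `A + B` is one `prepend`; the rest is the disjoint case.
rectangleProduct : ∀ e {l a b A B x} → a + b ≤ l → x ≤ A → A ≤ x + B → RectangleProduct (e + l) (e + a) (e + b) A B e x
rectangleProduct zero    = rectangleProduct-disjoint _ _ _ _ _ _
rectangleProduct (suc e) {l} {a} {b} {A} {B} {x} a+b≤l x≤A A≤x+B = record
  { numbers = prepend B numbers
  ; isPattern = prepend-pattern B numbers bounded (box-antitone (suc e + a) A 0) (box-antitone (e + a) A) isPattern
  ; bounded = prepend-bounded B numbers bounded
  ; content = prepend-content B numbers (e + l) (e + b) content
  ; rows-≤  = rows
  }
  where
  open RectangleProduct (rectangleProduct e {l} {a} {b} a+b≤l x≤A A≤x+B)
  rows : ∀ p y → (p < suc e → A + B ≤ y) → (p < suc e + a → p < suc e + b → x + B ≤ y) → (p < suc e + a → A ≤ y) →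
         (p < suc e + b → B ≤ y) → (p < suc e + a + (suc e + b) → A ≤ x + y) →
         box (suc e + a) A p + ∑ (suc e + l) (prepend B numbers p) ≤ y
  rows zero    y top _ _ _ _ rewrite prepend-row-0 B numbers (e + l) = top (s≤s z≤n)
  rows (suc p) y top both onlyA onlyB above rewrite prepend-row-suc B numbers p (e + l) =
    rows-≤ p y (top ∘ s≤s) (λ u v → both (s≤s u) (s≤s v)) (onlyA ∘ s≤s) (onlyB ∘ s≤s)
      (λ u → above (s≤s (≤-trans u (+-monoʳ-≤ (e + a) (n≤1+n _)))))

-- Rectangles and row functions as Young diagrams

rect-row : ∀ {a A} (a≤l : a ≤ l) (A≤k : A ≤ k) i → row (rect a A a≤l A≤k) i ≡ box a A (toℕ i)
rect-row {a = a} {A} a≤l A≤k i = trans (cong toℕ (lookup∘tabulate (rectRow a A a≤l A≤k) i)) go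
  where
  go : toℕ (rectRow a A a≤l A≤k i) ≡ box a A (toℕ i)
  go with toℕ i <? a
  ... | yes i<a = trans (toℕ-fromℕ< (s≤s A≤k)) (sym (box-< A i<a))
  ... | no  i≮a = sym (box-≥ A (≮⇒≥ i≮a))

rect-contains : ∀ {a A} (a≤l : a ≤ l) (A≤k : A ≤ k) {α} → rect a A a≤l A≤k ⊆ α → Contains (ρ α) a A
rect-contains {A = A} a≤l A≤k {α} ⊆α r r<a with index< (<-≤-trans r<a a≤l)
... | i , refl = subst₂ _≤_ (trans (rect-row a≤l A≤k i) (box-< A r<a)) (sym (ρ-toℕ α i)) (⊆α i)

module _ {k : ℕ} {f : ℕ → ℕ} (f-antitone : Antitone f) (f≤k : f 0 ≤ k) where

  private
    part : Fin l → Fin (suc k)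
    part i = fromℕ< (s≤s (≤-trans (antitone f-antitone (z≤n {toℕ i})) f≤k))

    toℕ-part : (i : Fin l) → toℕ (part i) ≡ f (toℕ i)
    toℕ-part i = toℕ-fromℕ< _

  fromRows : Young l k
  fromRows = young (tabulate part)
    (linked-tabulate part λ {i} {j} i≤j → subst₂ _≤_ (sym (toℕ-part j)) (sym (toℕ-part i)) (antitone f-antitone i≤j))

  fromRows-row : (i : Fin l) → row fromRows i ≡ f (toℕ i)
  fromRows-row i = trans (cong toℕ (lookup∘tabulate part i)) (toℕ-part i)

-- Sufficiency of the conditions

-- Only the first outer row is compared with `k`, because the column condition makes the outer rows
-- weakly decreasing.
pattern-tableau : ∀ {f t} → Pattern f t → (α β : Young l k) → (∀ i → row α i ≡ f (toℕ i)) →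
  (∀ i → row β i ≡ ∑ l (λ r → t r (toℕ i))) → f 0 + ∑ l (t 0) ≤ k →
  ∃[ ε ] ((∀ i → row ε i ≡ f (toℕ i) + ∑ l (t (toℕ i))) × LRTableau α β ε)
pattern-tableau {l} {f = f} {t} P α β α≡ β≡ ≤k = fromRows outer ≤k , fromRows-row outer ≤k , realise P α≡ β≡ (fromRows-row outer ≤k)
  where
  outer : Antitone (λ r → f r + ∑ l (t r))
  outer r = ≤-trans (+-monoʳ-≤ (f (suc r)) (m≤m+n _ _)) (Pattern.column P r l)

-- Insertion with `x = k − C`: the imaginary top row then has length `k`, which keeps the outer
-- shape inside the rectangle.
rectangle-tableau : ∀ {c C} (c≤l : c ≤ l) (C≤k : C ≤ k) (ε : Young l k) → ρ ε (l ∸ c) ≤ k ∸ C →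
  ∃[ δ ] LRTableau ε (rect c C c≤l C≤k) δ
rectangle-tableau {l} {k} {c} {C} c≤l C≤k ε fits =
  let δ , _ , τ = pattern-tableau insertion-pattern ε _ (λ i → sym (ρ-toℕ ε i))
        (λ i → trans (rect-row c≤l C≤k i) (sym (insertion-content c≤l fits (toℕ i)))) width
  in δ , τ
  where
  k≡ : k ∸ C + C ≡ k
  k≡ = m∸n+n≡m C≤k
  open Insertion (ρ ε) (ρ-antitone ε) c C (k ∸ C) (subst (ρ ε 0 ≤_) (sym k≡) (ρ≤k ε 0))
  width : ρ ε 0 + ∑ l (insertion 0) ≤ k
  width = begin
    ρ ε 0 + ∑ l (insertion 0)             ≤⟨ +-monoˡ-≤ _ (m≤m⊔n (ρ ε 0) (k ∸ C)) ⟩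
    (ρ ε 0 ⊔ (k ∸ C)) + ∑ l (insertion 0) ≡⟨ +-comm _ (∑ l (insertion 0)) ⟩
    ∑ l (insertion 0) + (ρ ε 0 ⊔ (k ∸ C)) ≡⟨ insertion-row c≤l 0 ⟩
    height (1 ∸ c)                        ≤⟨ antitone height-step (z≤n {1 ∸ c}) ⟩
    k ∸ C + C                             ≡⟨ k≡ ⟩
    k                                     ∎
    where open ≤-Reasoning

rectangleProduct-overlap : ∀ {l a b A B x} → a ≤ l → b ≤ l → x ≤ A → A ≤ x + B → RectangleProduct l a b A B (a + b ∸ l) x
rectangleProduct-overlap {l} {a} {b} {A} {B} {x} a≤l b≤l x≤A A≤x+B =
  subst₂ (λ m n → RectangleProduct m n b A B e x) (m+[n∸m]≡n e≤l) (m+[n∸m]≡n e≤a)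
    (subst (λ n → RectangleProduct (e + (l ∸ e)) (e + (a ∸ e)) n A B e x) (m+[n∸m]≡n e≤b)
      (rectangleProduct e disjoint-rest x≤A A≤x+B))
  where
  e = a + b ∸ l
  e≤a : e ≤ a
  e≤a = m≤n+o⇒m∸n≤o (a + b) l (≤-trans (+-monoʳ-≤ a b≤l) (≤-reflexive (+-comm a l)))
  e≤b : e ≤ b
  e≤b = m≤n+o⇒m∸n≤o (a + b) l (+-monoˡ-≤ b a≤l)
  e≤l : e ≤ l
  e≤l = ≤-trans e≤a a≤l
  disjoint-rest : (a ∸ e) + (b ∸ e) ≤ l ∸ e
  disjoint-rest = m+n≤o⇒m≤o∸n _ (begin
    (a ∸ e) + (b ∸ e) + e     ≡⟨ +-assoc (a ∸ e) _ _ ⟩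
    (a ∸ e) + ((b ∸ e) + e)   ≡⟨ cong ((a ∸ e) +_) (m∸n+n≡m e≤b) ⟩
    (a ∸ e) + b               ≡⟨ +-∸-comm b e≤a ⟨
    a + b ∸ e                 ≤⟨ m≤n+o⇒m∸n≤o (a + b) e (≤-trans (m≤n+m∸n (a + b) l) (≤-reflexive (+-comm l e))) ⟩
    l                         ∎)
    where open ≤-Reasoning

module _ {l k a b c A B C : ℕ} (a≤l : a ≤ l) (b≤l : b ≤ l) (c≤l : c ≤ l) (A≤k : A ≤ k) (B≤k : B ≤ k) (C≤k : C ≤ k)
         (conditions : Conditions l k a b c A B C) where

  private
    -- The third rectangle can be added as soon as row `p` of `ε` has length at most `y`.
    p = l ∸ c
    y = k ∸ C

    forced : ∀ {P Q : Set} → ¬ P → P ⊎ Q → Q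
    forced ¬p (inj₁ p) = contradiction p ¬p
    forced ¬p (inj₂ q) = q

    A+B≤k : 0 < a + b ∸ l → A + B ≤ k
    A+B≤k 0<e = forced (λ a+b≤l → <⇒≢ 0<e (sym (m≤n⇒m∸n≡0 a+b≤l))) (proj₁ conditions)

    -- If row `p` meets `a × A`, then `a + c ≤ l` fails and (ii) forces its second alternative. The
    -- next three bounds follow likewise from (iii), (iv) and (v).
    A≤y : p < a → A ≤ y
    A≤y p<a = m+n≤o⇒m≤o∸n A (forced (λ h → <⇒≱ p<a (m+n≤o⇒m≤o∸n a h)) (proj₁ (proj₂ conditions)))

    B≤y : p < b → B ≤ y
    B≤y p<b = m+n≤o⇒m≤o∸n B (forced (λ h → <⇒≱ p<b (m+n≤o⇒m≤o∸n b h)) (proj₁ (proj₂ (proj₂ conditions))))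

    A+B+C≤2k : p < a + b → A + B + C ≤ 2 * k
    A+B+C≤2k p<a+b = forced (λ h → <⇒≱ p<a+b (m+n≤o⇒m≤o∸n (a + b) h)) (proj₁ (proj₂ (proj₂ (proj₂ conditions))))

    A+B≤y : p < a + b ∸ l → A + B ≤ y
    A+B≤y p<e = m+n≤o⇒m≤o∸n (A + B) (forced (λ h → <⇒≱ p<e (m≤n+o⇒m∸n≤o (a + b) l (begin
      a + b          ≤⟨ m+n≤o⇒m≤o∸n (a + b) h ⟩
      2 * l ∸ c      ≡⟨ cong (λ n → l + n ∸ c) (+-identityʳ l) ⟩
      l + l ∸ c      ≡⟨ +-∸-assoc l c≤l ⟩
      l + (l ∸ c)    ∎))) (proj₂ (proj₂ (proj₂ (proj₂ conditions)))))
      where open ≤-Reasoning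

    R₁ : Young l k
    R₁ = rect a A a≤l A≤k
    R₂ : Young l k
    R₂ = rect b B b≤l B≤k
    R₃ : Young l k
    R₃ = rect c C c≤l C≤k

    Goal : Set
    Goal = ∃[ ε ] ∃[ δ ] (LRTableau R₁ R₂ ε × LRTableau ε R₃ δ)

    -- What remains is the choice of `x`: the hypotheses make `rows-≤` bound row 0 by `k` and row
    -- `p` by `y`.
    build : ∀ x → x ≤ A → A ≤ x + B → x + B ≤ k → (p < a → p < b → x + B ≤ y) → (p < a + b → A ≤ x + y) → Goal
    build x x≤A A≤x+B x+B≤k both above =
      let ε , ε≡ , τ = pattern-tableau isPattern R₁ R₂ (rect-row a≤l A≤k)
            (λ i → trans (rect-row b≤l B≤k i) (sym (content (toℕ i))))
            (rows-≤ 0 k A+B≤k (λ _ _ → x+B≤k) (λ _ → A≤k) (λ _ → B≤k) (λ _ → ≤-trans A≤k (m≤n+m k x)))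
          δ , τ′ = rectangle-tableau c≤l C≤k ε (fit ε ε≡)
      in ε , δ , τ , τ′
      where
      open RectangleProduct (rectangleProduct-overlap a≤l b≤l x≤A A≤x+B)
      fit : ∀ ε → (∀ i → row ε i ≡ box a A (toℕ i) + ∑ l (numbers (toℕ i))) → ρ ε p ≤ y
      fit ε ε≡ with p <? l
      -- When `c = 0`, row `p = l` lies outside the diagram and has length 0.
      ... | no  p≮l = ≤-trans (≤-reflexive (ext-≥ (row ε) (≮⇒≥ p≮l))) z≤n
      ... | yes p<l with index< p<l
      ...   | i , i≡p = begin
        ρ ε p                             ≡⟨ cong (ρ ε) i≡p ⟨
        ρ ε (toℕ i)                       ≡⟨ ρ-toℕ ε i ⟩
        row ε i                           ≡⟨ ε≡ i ⟩
        box a A (toℕ i) + ∑ l (numbers (toℕ i)) ≡⟨ cong (λ r → box a A r + ∑ l (numbers r)) i≡p ⟩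
        box a A p + ∑ l (numbers p)       ≤⟨ rows-≤ p y A+B≤y both A≤y B≤y above ⟩
        y                                 ∎
        where open ≤-Reasoning

    -- The largest `x` with `x ≤ A` and `x + B ≤ k` makes the length `A − x` below both rectangles
    -- smallest. The bound `A ≤ (k − B) + y` is `A + B + C ≤ 2k` rearranged.
    below : (p < a → p < b → A ⊓ (k ∸ B) + B ≤ y) → Goal
    below both = build (A ⊓ (k ∸ B)) (m⊓n≤m A _) (add B (m≤m+n A B) (≤-trans A≤k (≤-reflexive (sym k≡))))
      (≤-trans (+-monoˡ-≤ B (m⊓n≤n A _)) (≤-reflexive k≡)) both
      (λ p<a+b → add y (m≤m+n A y) (+-cancelʳ-≤ (B + C) A _ (begin
        A + (B + C)                       ≡⟨ +-assoc A B C ⟨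
        A + B + C                         ≤⟨ A+B+C≤2k p<a+b ⟩
        2 * k                             ≡⟨ cong (k +_) (+-identityʳ k) ⟩
        k + k                             ≡⟨ cong₂ _+_ k≡ (m∸n+n≡m C≤k) ⟨
        (k ∸ B) + B + (k ∸ C + C)         ≡⟨ interchange (k ∸ B) B y C ⟩
        (k ∸ B) + y + (B + C)             ∎)))
      where
      open ≤-Reasoning
      k≡ : k ∸ B + B ≡ k
      k≡ = m∸n+n≡m B≤k
      add : ∀ z → A ≤ A + z → A ≤ k ∸ B + z → A ≤ A ⊓ (k ∸ B) + z
      add z u v = ≤-trans (⊓-glb u v) (≤-reflexive (sym (+-distribʳ-⊓ z A (k ∸ B))))

  -- The first choice of x minimises row l − c when this row meets both
  -- rectangles, the second one when it lies below at least one of them.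
  sufficient : Goal
  sufficient with p <? a | p <? b
  ... | yes p<a | yes p<b = build (A ∸ B) (m∸n≤m A B) A≤x+B (x+B≤ A≤k B≤k) (λ _ _ → x+B≤ (A≤y p<a) (B≤y p<b))
                              (λ _ → ≤-trans A≤x+B (+-monoʳ-≤ (A ∸ B) (B≤y p<b)))
    where
    A≤x+B : A ≤ A ∸ B + B
    A≤x+B = ≤-trans (m≤n+m∸n A B) (≤-reflexive (+-comm B _))
    -- `A ∸ B + B` is the maximum of `A` and `B`.
    x+B≤ : ∀ {z} → A ≤ z → B ≤ z → A ∸ B + B ≤ z
    x+B≤ {z} A≤z B≤z with ≤-total A B
    ... | inj₁ A≤B = subst (λ d → d + B ≤ z) (sym (m≤n⇒m∸n≡0 A≤B)) B≤z
    ... | inj₂ B≤A = subst (_≤ z) (sym (m∸n+n≡m B≤A)) A≤z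
  ... | no p≮a | _      = below λ p<a _ → contradiction p<a p≮a
  ... | yes _  | no p≮b = below λ _ p<b → contradiction p<b p≮b


-- Products of Schubert classes

parts-injective : {α β : Young l k} → parts α ≡ parts β → α ≡ β
parts-injective {α = young p d} {young _ d′} refl = cong (young p) (irrelevant ≤-irrelevant d d′)

∈-vecs : (xs : List X) → (∀ x → x ∈ xs) → (v : Vec X n) → v ∈ vecs xs n
∈-vecs xs all []      = here refl
∈-vecs xs all (x ∷ v) = ∈-cartesianProductWith⁺ _∷_ (all x) (∈-vecs xs all v)

∈-allYoung : (α : Young l k) → α ∈ allYoung l k
∈-allYoung {l} {k} α = Anyₚ.mapMaybe⁺ _ _ (Anyₚ.map⁺ (lose (∈-vecs (allFin (suc k)) ∈-allFin (parts α)) found))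
  where
  found : MAny.Any (α ≡_) (Maybe.map (young (parts α)) (dec⇒maybe (linked? (λ i j → j Fin.≤? i) (parts α))))
  found with linked? (λ i j → j Fin.≤? i) (parts α)
  ... | yes d = just (parts-injective refl)
  ... | no ¬d = contradiction (decreasing α) ¬d

lrCoeff⁻ : (α β γ : Young l k) → lrCoeff α β γ ≢ 0 → LRTableau α β γ
lrCoeff⁻ {l} {k} α β γ ≢0 = go _ refl
  where
  go : ∀ Ts → Ts ≡ filter (isLRTableau? α β γ) (allFillings l k) → LRTableau α β γ
  go []       eq = contradiction (cong length (sym eq)) ≢0
  go (T ∷ Ts) eq = lrTableau T (proj₂ (∈-filter⁻ (isLRTableau? α β γ) {xs = allFillings l k} (subst (T ∈_) eq (here refl))))

lrCoeff⁺ : {α β γ : Young l k} → LRTableau α β γ → lrCoeff α β γ ≢ 0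
lrCoeff⁺ {l} {k} {α} {β} {γ} (lrTableau T isLR) = >⇒≢ (∈-length (∈-filter⁺ (isLRTableau? α β γ)
  (∈-vecs (vecs (allFin (suc l)) k) (∈-vecs (allFin (suc l)) ∈-allFin) T) isLR))

sumℤ : (X → ℤ) → List X → ℤ
sumℤ f xs = foldr ℤ._+_ 0ℤ (map f xs)

sumℤ⁻ : (f : X → ℤ) (xs : List X) → sumℤ f xs ≢ 0ℤ → ∃[ x ] f x ≢ 0ℤ
sumℤ⁻ f []       ≢0 = contradiction refl ≢0
sumℤ⁻ f (x ∷ xs) ≢0 with f x ℤₚ.≟ 0ℤ
... | no fx≢0  = x , fx≢0
... | yes fx≡0 = sumℤ⁻ f xs λ eq → ≢0 (cong₂ ℤ._+_ fx≡0 eq)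

sumℤ-nonneg : (f : X → ℤ) (xs : List X) → (∀ x → 0ℤ ℤ.≤ f x) → 0ℤ ℤ.≤ sumℤ f xs
sumℤ-nonneg f []       f≥0 = ℤₚ.≤-refl
sumℤ-nonneg f (x ∷ xs) f≥0 = ℤₚ.+-mono-≤ (f≥0 x) (sumℤ-nonneg f xs f≥0)

-- Nonnegative terms cannot cancel, so a single tableau makes a coefficient of a product of Schubert
-- classes nonzero.
sumℤ⁺ : (f : X → ℤ) {xs : List X} {x : X} → (∀ x → 0ℤ ℤ.≤ f x) → x ∈ xs → f x ≢ 0ℤ → sumℤ f xs ≢ 0ℤ
sumℤ⁺ f f≥0 x∈xs fx≢0 = ≢-sym (ℤₚ.<⇒≢ (go x∈xs))
  where
  go : ∀ {xs} → _ ∈ xs → 0ℤ ℤ.< sumℤ f xs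
  go {x ∷ xs} (here refl) = ℤₚ.+-mono-<-≤ (ℤₚ.≤∧≢⇒< (f≥0 x) (≢-sym fx≢0)) (sumℤ-nonneg f xs f≥0)
  go {x ∷ xs} (there p)   = ℤₚ.+-mono-≤-< (f≥0 x) (go p)

*-nonneg : ∀ {i j} → 0ℤ ℤ.≤ i → 0ℤ ℤ.≤ j → 0ℤ ℤ.≤ i ℤ.* j
*-nonneg {ℤ.+ m} {ℤ.+ n} _ _ = subst (0ℤ ℤ.≤_) (ℤₚ.pos-* m n) (ℤ.+≤+ z≤n)

*-≢0 : ∀ {i j} → i ≢ 0ℤ → j ≢ 0ℤ → i ℤ.* j ≢ 0ℤ
*-≢0 {i} i≢0 j≢0 eq with ℤₚ.i*j≡0⇒i≡0∨j≡0 i eq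
... | inj₁ i≡0 = i≢0 i≡0
... | inj₂ j≡0 = j≢0 j≡0

*-≢0⁻ : ∀ {i j} → i ℤ.* j ≢ 0ℤ → i ≢ 0ℤ × j ≢ 0ℤ
*-≢0⁻ {i} {j} ≢0 = (λ eq → ≢0 (cong (ℤ._* j) eq)) , (λ eq → ≢0 (trans (cong (i ℤ.*_) eq) (ℤₚ.*-zeroʳ i)))

Nonneg : Cohomology l k → Set
Nonneg x = ∀ γ → 0ℤ ℤ.≤ x γ

module _ {l k : ℕ} (x y : Cohomology l k) (γ : Young l k) where

  private
    term : Young l k → Young l k → ℤ
    term α β = x α ℤ.* y β ℤ.* ℤ.+ lrCoeff α β γ

  ·-support⁻ : (x · y) γ ≢ 0ℤ → ∃[ α ] ∃[ β ] (x α ≢ 0ℤ × y β ≢ 0ℤ × LRTableau α β γ)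
  ·-support⁻ ≢0 =
    let α , ≢0′ = sumℤ⁻ (λ α → sumℤ (term α) (allYoung l k)) (allYoung l k) ≢0
        β , ≢0″ = sumℤ⁻ (term α) (allYoung l k) ≢0′
        xy≢0 , c≢0 = *-≢0⁻ ≢0″
        x≢0 , y≢0 = *-≢0⁻ xy≢0
    in α , β , x≢0 , y≢0 , lrCoeff⁻ α β γ (λ eq → c≢0 (cong ℤ.+_ eq))

  module _ (x≥0 : Nonneg x) (y≥0 : Nonneg y) where

    private
      term≥0 : ∀ α β → 0ℤ ℤ.≤ term α β
      term≥0 α β = *-nonneg (*-nonneg (x≥0 α) (y≥0 β)) (ℤ.+≤+ z≤n)

    ·-nonneg : 0ℤ ℤ.≤ (x · y) γ
    ·-nonneg = sumℤ-nonneg (λ α → sumℤ (term α) (allYoung l k)) (allYoung l k) λ α → sumℤ-nonneg (term α) (allYoung l k) (term≥0 α)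

    ·-support⁺ : ∀ {α β} → x α ≢ 0ℤ → y β ≢ 0ℤ → LRTableau α β γ → (x · y) γ ≢ 0ℤ
    ·-support⁺ {α} {β} xα≢0 yβ≢0 τ =
      sumℤ⁺ (λ α → sumℤ (term α) (allYoung l k)) (λ α → sumℤ-nonneg (term α) (allYoung l k) (term≥0 α)) (∈-allYoung α)
        (sumℤ⁺ (term α) (term≥0 α) (∈-allYoung β)
          (*-≢0 (*-≢0 xα≢0 yβ≢0) (lrCoeff⁺ τ ∘ ℤₚ.+-injective)))

σ-self : (α : Young l k) → σ α α ≢ 0ℤ
σ-self α rewrite dec-true (≡-dec Finₚ._≟_ (parts α) (parts α)) refl = λ ()

σ-support : (α β : Young l k) → σ α β ≢ 0ℤ → α ≡ β
σ-support α β ≢0 with ≡-dec Finₚ._≟_ (parts α) (parts β)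
... | yes eq = parts-injective eq
... | no  _  = contradiction refl ≢0

σ-nonneg : (α : Young l k) → Nonneg (σ α)
σ-nonneg α β with ≡-dec Finₚ._≟_ (parts α) (parts β)
... | yes _ = ℤ.+≤+ z≤n
... | no  _ = ℤ.+≤+ z≤n

σσσ-support⁻ : (α β γ δ : Young l k) → (σ α · σ β · σ γ) δ ≢ 0ℤ → ∃[ ε ] (LRTableau α β ε × LRTableau ε γ δ)
σσσ-support⁻ α β γ δ ≢0 =
  let ε , γ′ , ε≢0 , γ≢0 , τ′ = ·-support⁻ (σ α · σ β) (σ γ) δ ≢0
      α′ , β′ , α≢0 , β≢0 , τ = ·-support⁻ (σ α) (σ β) ε ε≢0
  in ε , subst₂ (λ α β → LRTableau α β ε) (sym (σ-support α α′ α≢0)) (sym (σ-support β β′ β≢0)) τ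
       , subst (λ γ → LRTableau ε γ δ) (sym (σ-support γ γ′ γ≢0)) τ′

σσσ-support⁺ : {α β γ ε δ : Young l k} → LRTableau α β ε → LRTableau ε γ δ → (σ α · σ β · σ γ) δ ≢ 0ℤ
σσσ-support⁺ {α = α} {β} {γ} {ε} {δ} τ τ′ = ·-support⁺ (σ α · σ β) (σ γ) δ
  (λ ε → ·-nonneg (σ α) (σ β) ε (σ-nonneg α) (σ-nonneg β)) (σ-nonneg γ)
  (·-support⁺ (σ α) (σ β) ε (σ-nonneg α) (σ-nonneg β) (σ-self α) (σ-self β) τ) (σ-self γ) τ′

-- The equivalences

conditions? : ∀ l k a b c A B C → Dec (Conditions l k a b c A B C)
conditions? l k a b c A B C =
  ((a + b ≤? l) ⊎-dec (A + B ≤? k)) ×-dec ((a + c ≤? l) ⊎-dec (A + C ≤? k)) ×-dec ((b + c ≤? l) ⊎-dec (B + C ≤? k))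
  ×-dec ((a + b + c ≤? l) ⊎-dec (A + B + C ≤? 2 * k)) ×-dec ((a + b + c ≤? 2 * l) ⊎-dec (A + B + C ≤? k))

theorem1p3 :
    ∀ (l k : ℕ) → 1 ≤ l → 1 ≤ k →
    ∀ (a b c A B C : ℕ)
      (a≤l : a ≤ l) (b≤l : b ≤ l) (c≤l : c ≤ l)
      (A≤k : A ≤ k) (B≤k : B ≤ k) (C≤k : C ≤ k) →
    let R₁ = rect {l} {k} a A a≤l A≤k
        R₂ = rect {l} {k} b B b≤l B≤k
        R₃ = rect {l} {k} c C c≤l C≤k
        I = ∃[ α ] ∃[ β ] ∃[ γ ]
              (R₁ ⊆ α × R₂ ⊆ β × R₃ ⊆ γ × Nonzero (σ α · σ β · σ γ))
        II = Nonzero (σ R₁ · σ R₂ · σ R₃)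
        III = (a + b ≤ l ⊎ A + B ≤ k)
            × (a + c ≤ l ⊎ A + C ≤ k)
            × (b + c ≤ l ⊎ B + C ≤ k)
            × (a + b + c ≤ l ⊎ A + B + C ≤ 2 * k)
            × (a + b + c ≤ 2 * l ⊎ A + B + C ≤ k)
    in (I ⇔ II) × (II ⇔ III)
theorem1p3 l k _ _ a b c A B C a≤l b≤l c≤l A≤k B≤k C≤k =
    -- From (I) to (II) the way leads through (III): `conditions` accepts any diagrams containing
    -- the rectangles.
    mk⇔ (λ (α , β , γ , ⊆α , ⊆β , ⊆γ , ≢0) → nonzero (conditions α β γ ⊆α ⊆β ⊆γ ≢0)) II⇒I
  , mk⇔ (conditions R₁ R₂ R₃ (λ _ → ≤-refl) (λ _ → ≤-refl) (λ _ → ≤-refl)) nonzero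
  where
  R₁ = rect {l} {k} a A a≤l A≤k
  R₂ = rect {l} {k} b B b≤l B≤k
  R₃ = rect {l} {k} c C c≤l C≤k
  II⇒I : Nonzero (σ R₁ · σ R₂ · σ R₃) → ∃[ α ] ∃[ β ] ∃[ γ ] (R₁ ⊆ α × R₂ ⊆ β × R₃ ⊆ γ × Nonzero (σ α · σ β · σ γ))
  II⇒I ≢0 = R₁ , R₂ , R₃ , (λ _ → ≤-refl) , (λ _ → ≤-refl) , (λ _ → ≤-refl) , ≢0
  nonzero : Conditions l k a b c A B C → Nonzero (σ R₁ · σ R₂ · σ R₃)
  nonzero h all≡0 with sufficient a≤l b≤l c≤l A≤k B≤k C≤k h
  ... | ε , δ , τ , τ′ = σσσ-support⁺ {α = R₁} {R₂} {R₃} τ τ′ (all≡0 δ)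
  conditions : ∀ α β γ → R₁ ⊆ α → R₂ ⊆ β → R₃ ⊆ γ → Nonzero (σ α · σ β · σ γ) → Conditions l k a b c A B C
  -- `Nonzero` is a negated universal statement and provides no `δ`. Decidability of the conditions
  -- and of equality in ℤ allows arguing by contradiction for each `δ`.
  conditions α β γ ⊆α ⊆β ⊆γ ≢0 = decidable-stable (conditions? l k a b c A B C) λ fails → ≢0 λ δ →
    decidable-stable ((σ α · σ β · σ γ) δ ℤₚ.≟ 0ℤ) λ δ≢0 → let ε , τ , τ′ = σσσ-support⁻ α β γ δ δ≢0 in
      fails (necessary τ τ′ a≤l b≤l c≤l A≤k B≤k C≤k
        (rect-contains a≤l A≤k {α} ⊆α) (rect-contains b≤l B≤k {β} ⊆β) (rect-contains c≤l C≤k {γ} ⊆γ))
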